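{- Let $\mathbb{F}$ be a field, let $n\ge 1$, and let $A=(a_{i,j})$ be an $n\times n$ matrix with entries in $\mathbb{F}$. Then \[ \det(A)=\sum_{P\in\operatorname{PP}(n)}\operatorname{sgn}(P)\,|P|!\,\prod_{i=1}^n \begin{cases} \displaystyle\sum_{j\sim_P i,\ j\neq i} a_{i,j} & \text{if } i\sim_P i,\\[2mm] \displaystyle a_{i,i}+\sum_{j:\ j\sim_P j} a_{i,j} & \text{if } i\not\sim_P i,\end{cases} \] where $\operatorname{sgn}(P)=\prod_{S\in P}(-1)^{|S|+1}$.
   Context: $[n]=\{1,\dots,n\}$. A partial partition of $[n]$ is a set $P$ of pairwise disjoint nonempty subsets (parts) of $[n]$ (their union need not be $[n]$); $\operatorname{PP}(n)$ is the set of all partial partitions of $[n]$ and $|P|$ is the number of parts of $P$. For $i,j\in[n]$, write $i\sim_P j$ if some part of $P$ contains both $i$ and $j$ (so $i\sim_P i$ holds iff $i$ lies in some part of $P$). Empty sums are $0$ and $0!=1$. -}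

module Defs where

open import Level using (Level; _⊔_) renaming (suc to lsuc)
open import Data.Nat using (ℕ; zero; suc)
open import Data.Bool using (Bool; true; false; if_then_else_; _∧_; not)
open import Data.Fin using (Fin; _<?_)
open import Data.Fin.Properties using () renaming (_≟_ to _≟ᶠ_)
open import Data.List using (List; []; _∷_; map; concatMap; filterᵇ; foldr; length; allFin)
open import Data.Vec using (Vec; []; _∷_; lookup)
open import Data.Product using (∃)
open import Relation.Nullary using (¬_)
open import Relation.Nullary.Decidable using (⌊_⌋)
open import Algebra.Bundles using (CommutativeRing)

record Field (c ℓ : Level) : Set (lsuc (c ⊔ ℓ)) where
  field
    commutativeRing : CommutativeRing c ℓ
  open CommutativeRing commutativeRing public
  field
    0≉1     : ¬ (0# ≈ 1#)
    inverse : ∀ x → ¬ (x ≈ 0#) → ∃ λ y → (x * y) ≈ 1#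

allVecsOver : ∀ {a} {A : Set a} → List A → (m : ℕ) → List (Vec A m)
allVecsOver xs zero    = [] ∷ []
allVecsOver xs (suc m) = concatMap (λ v → map (λ x → x ∷ v) xs) (allVecsOver xs m)

allᵇ : ∀ {a} {A : Set a} → (A → Bool) → List A → Bool
allᵇ p xs = foldr (λ x b → p x ∧ b) true xs

count : ∀ {a} {A : Set a} → (A → Bool) → List A → ℕ
count p xs = length (filterᵇ p xs)

_==_ : ∀ {n} → Fin n → Fin n → Bool
i == j = ⌊ i ≟ᶠ j ⌋

_<ᵇ_ : ∀ {n} → Fin n → Fin n → Bool
i <ᵇ j = ⌊ i <? j ⌋

_⇒ᵇ_ : Bool → Bool → Bool
true  ⇒ᵇ b = b
false ⇒ᵇ b = true

Matrix : ∀ {a} → Set a → ℕ → Set a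
Matrix X n = Fin n → Fin n → X

-- Partial partitions of [n].
-- A partial partition P is represented by its relation ∼_P, encoded as a
-- boolean n × n table R with  R i j = true  iff  i ∼_P j.  A boolean
-- relation is of the form ∼_P for a (unique) partial partition P iff it
-- is symmetric and transitive; P is then the set of its equivalence
-- classes on {i | i ∼ i}.  So P ↦ ∼_P is a bijection from PP(n) onto the
-- symmetric transitive boolean relations, and PP n lists each partial
-- partition exactly once.

PRel : ℕ → Set
PRel n = Vec (Vec Bool n) n

_∼⟨_⟩_ : ∀ {n} → Fin n → PRel n → Fin n → Bool
i ∼⟨ R ⟩ j = lookup (lookup R i) j

isPartialPartition : ∀ {n} → PRel n → Bool
isPartialPartition {n} R =
  allᵇ (λ i → allᵇ (λ j →
      ((i ∼⟨ R ⟩ j) ⇒ᵇ (j ∼⟨ R ⟩ i)) ∧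
      allᵇ (λ k → ((i ∼⟨ R ⟩ j) ∧ (j ∼⟨ R ⟩ k)) ⇒ᵇ (i ∼⟨ R ⟩ k)) (allFin n))
    (allFin n)) (allFin n)

PP : (n : ℕ) → List (PRel n)
PP n = filterᵇ isPartialPartition (allVecsOver (allVecsOver (true ∷ false ∷ []) n) n)

partOf : ∀ {n} → PRel n → Fin n → List (Fin n)
partOf {n} R i = filterᵇ (λ j → i ∼⟨ R ⟩ j) (allFin n)

isPartMin : ∀ {n} → PRel n → Fin n → Bool
isPartMin {n} R i = (i ∼⟨ R ⟩ i) ∧ allᵇ (λ j → (j ∼⟨ R ⟩ i) ⇒ᵇ not (j <ᵇ i)) (allFin n)

parts : ∀ {n} → PRel n → List (List (Fin n))
parts {n} R = map (partOf R) (filterᵇ (isPartMin R) (allFin n))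

numParts : ∀ {n} → PRel n → ℕ
numParts R = length (parts R)

module RingOps {c ℓ} (R : CommutativeRing c ℓ) where
  open CommutativeRing R

  ∑ : ∀ {a} {A : Set a} → List A → (A → Carrier) → Carrier
  ∑ xs f = foldr (λ x s → f x + s) 0# xs

  ∏ : ∀ {a} {A : Set a} → List A → (A → Carrier) → Carrier
  ∏ xs f = foldr (λ x s → f x * s) 1# xs

  ∑If : ∀ {a} {A : Set a} → List A → (A → Bool) → (A → Carrier) → Carrier
  ∑If xs p f = ∑ (filterᵇ p xs) f

  ⟦_⟧ : ℕ → Carrier
  ⟦ zero ⟧  = 0#
  ⟦ suc m ⟧ = 1# + ⟦ m ⟧

  neg1^ : ℕ → Carrier
  neg1^ zero    = 1#
  neg1^ (suc k) = (- 1#) * neg1^ k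

  isPermutation : ∀ {n} → Vec (Fin n) n → Bool
  isPermutation {n} σ = allᵇ (λ i → allᵇ (λ j →
    (lookup σ i == lookup σ j) ⇒ᵇ (i == j)) (allFin n)) (allFin n)

  permutations : (n : ℕ) → List (Vec (Fin n) n)
  permutations n = filterᵇ isPermutation (allVecsOver (allFin n) n)

  inversions : ∀ {n} → Vec (Fin n) n → ℕ
  inversions {n} σ = length (concatMap (λ i →
    filterᵇ (λ j → (i <ᵇ j) ∧ (lookup σ j <ᵇ lookup σ i)) (allFin n)) (allFin n))

  det : ∀ {n} → Matrix Carrier n → Carrier
  det {n} A = ∑ (permutations n) (λ σ → neg1^ (inversions σ) * ∏ (allFin n) (λ i → A i (lookup σ i)))

  sgnPP : ∀ {n} → PRel n → Carrier
  sgnPP R = ∏ (parts R) (λ S → neg1^ (suc (length S)))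

module Submission where

open import Defs
open import Level using (Level)
open import Data.Nat as ℕ using (ℕ; zero; suc; s≤s; _≥_; _!)
import Data.Nat.Properties as ℕ
open import Data.Bool using (Bool; true; false; if_then_else_; _∧_; _∨_; not)
import Data.Bool.Properties as Bool
open import Data.Fin using (Fin; zero; suc; toℕ; inject₁; punchOut; _<_; _<?_)
import Data.Fin.Properties as Fin
open import Data.Fin.Permutation.Components using (transpose; transpose-inverse)
open import Data.List as List using (List; []; _∷_; _++_; allFin; concatMap; filterᵇ; length)
import Data.List.Properties as List
open import Data.List.Membership.Propositional using (_∈_)
open import Data.List.Membership.Propositional.Properties using (∈-allFin)
open import Data.List.Relation.Unary.Any using (here; there)
open import Data.Vec as Vec using (Vec)
import Data.Vec.Properties as Vec
open import Data.Product using (∃; _×_; _,_; proj₁; proj₂)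
open import Data.Sum using (_⊎_; inj₁; inj₂)
open import Data.Empty using (⊥; ⊥-elim)
open import Function using (_∘_; id)
open import Function.Definitions using (Injective)
open import Algebra.Bundles using (CommutativeMonoid; CommutativeRing)
open import Relation.Binary.Definitions using (DecidableEquality; tri<; tri≈; tri>)
open import Relation.Binary.PropositionalEquality as ≡ using (_≡_; _≢_)
open import Relation.Nullary using (¬_; Dec; yes; no; ¬?)
open import Relation.Nullary.Decidable using (⌊_⌋; _×-dec_; dec-true; dec-false)

-- Expanding the product over i writes the right-hand side as a sum over all maps
-- f : [n] → [n] of c(f) ∏ a_{i,f(i)}, where c(f) sums sgn(P) |P|! over the P compatible
-- with f: covered points are moved within their part, uncovered ones are fixed or sent to
-- covered ones.  Moreover sgn(P) |P|! = (-1)^{#covered} (-1)^k k! with k = |P|.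
-- If x is not in the image of f, moving x in and out of the part of f(x) changes only
-- the sign, so c(f) = 0.  If f is a permutation σ, then P must cover exactly the points
-- moved by σ, and its parts are unions of cycles.  Remove the covered points x one at a
-- time: if σ(x) = y ≠ x, contracting x onto y replaces σ by (x y)σ and flips both
-- signs; if x has become a fixed point, it was either a part of its own or was in one of
-- the other k parts, and -(-1)^{k+1} (k+1)! - k (-1)^k k! = (-1)^k k!.  Hence
-- c(σ) = sgn(σ).

-- The factorial comes from Stirling numbers. If σ has c nontrivial cycles on m moved points, the
-- admissible P group these cycles into k parts, so c(σ) is (-1)^m times the sum over k of S(c,k)
-- (-1)^k k!, where S(c,k) counts the set partitions of c objects into k blocks. That sum equals
-- (-1)^c, and (-1)^(m+c) is sgn(σ). A direct argument would need the cycles of σ and the set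
-- partitions of the set of cycles. Removing single points runs the recursion behind this sum on the
-- relations themselves, and all that is used of sgn is that composing with a transposition flips
-- it. The price is that contracting a cycle ends in a fixed point that P must still cover, so the
-- set to be covered is carried along separately from σ.

private variable
  ℓ′ : Level
  X Y : Set ℓ′
  β γ : Bool
  n : ℕ

-- Booleans and finite types

⌊⌋-intro : ∀ {p} {P : Set p} (d : Dec P) → P → ⌊ d ⌋ ≡ true
⌊⌋-intro (yes _) _ = ≡.refl
⌊⌋-intro (no ¬p) p = ⊥-elim (¬p p)

⌊⌋-elim : ∀ {p} {P : Set p} (d : Dec P) → ⌊ d ⌋ ≡ true → P
⌊⌋-elim (yes p) _ = p

≢true⇒≡false : ¬ (β ≡ true) → β ≡ false
≢true⇒≡false {true}  h = ⊥-elim (h ≡.refl)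
≢true⇒≡false {false} _ = ≡.refl

true≢false : β ≡ true → β ≡ false → ⊥
true≢false ≡.refl ()

bool-ext : (β ≡ true → γ ≡ true) → (γ ≡ true → β ≡ true) → β ≡ γ
bool-ext {true}          f _ = ≡.sym (f ≡.refl)
bool-ext {false} {true}  _ g = g ≡.refl
bool-ext {false} {false} _ _ = ≡.refl

∧-intro : β ≡ true → γ ≡ true → β ∧ γ ≡ true
∧-intro ≡.refl ≡.refl = ≡.refl

∧-elim : β ∧ γ ≡ true → β ≡ true × γ ≡ true
∧-elim {true} {true} _ = ≡.refl , ≡.refl

∨-introʳ : γ ≡ true → β ∨ γ ≡ true
∨-introʳ {β = true}  _ = ≡.refl
∨-introʳ {β = false} h = h

∨-elim : β ∨ γ ≡ true → β ≡ true ⊎ γ ≡ true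
∨-elim {true}  _ = inj₁ ≡.refl
∨-elim {false} h = inj₂ h

not-intro : ¬ (β ≡ true) → not β ≡ true
not-intro {true}  h = ⊥-elim (h ≡.refl)
not-intro {false} _ = ≡.refl

not-elim : not β ≡ true → ¬ (β ≡ true)
not-elim {false} _ ()

⇒ᵇ-intro : (β ≡ true → γ ≡ true) → (β ⇒ᵇ γ) ≡ true
⇒ᵇ-intro {true}  h = h ≡.refl
⇒ᵇ-intro {false} _ = ≡.refl

⇒ᵇ-elim : (β ⇒ᵇ γ) ≡ true → β ≡ true → γ ≡ true
⇒ᵇ-elim {true} h _ = h

if-true : ∀ {x} {X : Set x} {u v : X} → β ≡ true → (if β then u else v) ≡ u
if-true ≡.refl = ≡.refl

if-false : ∀ {x} {X : Set x} {u v : X} → β ≡ false → (if β then u else v) ≡ v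
if-false ≡.refl = ≡.refl

==-intro : {i j : Fin n} → i ≡ j → (i == j) ≡ true
==-intro {i = i} {j} = ⌊⌋-intro (i Fin.≟ j)

==-elim : {i j : Fin n} → (i == j) ≡ true → i ≡ j
==-elim {i = i} {j} = ⌊⌋-elim (i Fin.≟ j)

==-false : {i j : Fin n} → i ≢ j → (i == j) ≡ false
==-false i≢j = ≢true⇒≡false (i≢j ∘ ==-elim)

allᵇ-tabulate-intro : ∀ {x} {X : Set x} {p : X → Bool} (f : Fin n → X) →
  (∀ i → p (f i) ≡ true) → allᵇ p (List.tabulate f) ≡ true
allᵇ-tabulate-intro {zero}  f h = ≡.refl
allᵇ-tabulate-intro {suc n} f h = ∧-intro (h zero) (allᵇ-tabulate-intro (f ∘ suc) (h ∘ suc))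

allᵇ-tabulate-elim : ∀ {x} {X : Set x} {p : X → Bool} (f : Fin n → X) →
  allᵇ p (List.tabulate f) ≡ true → ∀ i → p (f i) ≡ true
allᵇ-tabulate-elim f h zero    = proj₁ (∧-elim h)
allᵇ-tabulate-elim f h (suc i) = allᵇ-tabulate-elim (f ∘ suc) (proj₂ (∧-elim h)) i

allᵇ-intro : {p : Fin n → Bool} → (∀ i → p i ≡ true) → allᵇ p (allFin n) ≡ true
allᵇ-intro = allᵇ-tabulate-intro (λ i → i)

allᵇ-elim : {p : Fin n → Bool} → allᵇ p (allFin n) ≡ true → ∀ i → p i ≡ true
allᵇ-elim = allᵇ-tabulate-elim (λ i → i)

least : (p : Fin n → Bool) (j : Fin n) → p j ≡ true →
  ∃ λ m → p m ≡ true × (∀ k → p k ≡ true → ¬ k < m)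
least {suc n} p j pj with p zero in p0
... | true = zero , p0 , λ _ _ ()
least {suc n} p zero    pj | false = ⊥-elim (true≢false pj p0)
least {suc n} p (suc j) pj | false with least (p ∘ suc) j pj
... | m , pm , below = suc m , pm , λ
  { zero    pk _         → true≢false pk p0
  ; (suc k) pk (s≤s k<m) → below k pk k<m }

-- Pigeonhole: punching out a missed value x would inject `Fin (suc n)` into `Fin n`.
injective⇒surjective : {f : Fin n → Fin n} → Injective _≡_ _≡_ f → ∀ x → ∃ λ i → f i ≡ x
injective⇒surjective {suc n} {f} inj x with Fin.any? (λ i → f i Fin.≟ x)
... | yes hit  = hit
... | no  miss = ⊥-elim (ℕ.1+n≰n (Fin.injective⇒≤ {f = λ i → punchOut (x≢f i)}
                   (λ eq → inj (Fin.punchOut-injective (x≢f _) (x≢f _) eq))))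
  where
  x≢f : ∀ i → x ≢ f i
  x≢f i eq = miss (i , ≡.sym eq)

-- Partial partitions as relations

_∼[_]_ : Fin n → PRel n → Fin n → Set
i ∼[ P ] j = i ∼⟨ P ⟩ j ≡ true

record IsPP (P : PRel n) : Set where
  field
    ∼-sym   : ∀ {i j} → i ∼[ P ] j → j ∼[ P ] i
    ∼-trans : ∀ {i j k} → i ∼[ P ] j → j ∼[ P ] k → i ∼[ P ] k

  ∼-reflˡ : ∀ {i j} → i ∼[ P ] j → i ∼[ P ] i
  ∼-reflˡ h = ∼-trans h (∼-sym h)

  ∼-reflʳ : ∀ {i j} → i ∼[ P ] j → j ∼[ P ] j
  ∼-reflʳ h = ∼-trans (∼-sym h) h

isPP-elim : {P : PRel n} → isPartialPartition P ≡ true → IsPP P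
isPP-elim h = record
  { ∼-sym   = λ {i} {j} → ⇒ᵇ-elim (proj₁ (∧-elim (allᵇ-elim (allᵇ-elim h i) j)))
  ; ∼-trans = λ {i} {j} {k} u v →
      ⇒ᵇ-elim (allᵇ-elim (proj₂ (∧-elim (allᵇ-elim (allᵇ-elim h i) j))) k) (∧-intro u v)
  }

isPP-intro : {P : PRel n} → IsPP P → isPartialPartition P ≡ true
isPP-intro {n} {P} pp = allᵇ-intro {n} λ i → allᵇ-intro {n} λ j → ∧-intro (⇒ᵇ-intro (∼-sym {i} {j}))
    (allᵇ-intro {n} λ k → ⇒ᵇ-intro {(i ∼⟨ P ⟩ j) ∧ (j ∼⟨ P ⟩ k)} λ h →
      ∼-trans {i} {j} {k} (proj₁ (∧-elim h)) (proj₂ (∧-elim h)))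
  where open IsPP pp

fromRel : (Fin n → Fin n → Bool) → PRel n
fromRel g = Vec.tabulate (λ i → Vec.tabulate (g i))

∼-fromRel : (g : Fin n → Fin n → Bool) → ∀ i j → (i ∼⟨ fromRel g ⟩ j) ≡ g i j
∼-fromRel g i j = ≡.trans (≡.cong (λ v → Vec.lookup v j) (Vec.lookup∘tabulate (λ i → Vec.tabulate (g i)) i))
  (Vec.lookup∘tabulate (g i) j)

PRel-ext : {P Q : PRel n} → (∀ i j → (i ∼⟨ P ⟩ j) ≡ (i ∼⟨ Q ⟩ j)) → P ≡ Q
PRel-ext {P = P} {Q} h = vec-ext λ i → vec-ext (h i)
  where
  vec-ext : ∀ {x m} {X : Set x} {u v : Vec.Vec X m} → (∀ i → Vec.lookup u i ≡ Vec.lookup v i) → u ≡ v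
  vec-ext {u = u} {v} eq =
    ≡.trans (≡.sym (Vec.tabulate∘lookup u)) (≡.trans (Vec.tabulate-cong eq) (Vec.tabulate∘lookup v))

min-intro : {P : PRel n} {i : Fin n} → i ∼[ P ] i → (∀ j → j ∼[ P ] i → ¬ j < i) → isPartMin P i ≡ true
min-intro h below = ∧-intro h (allᵇ-intro λ j → ⇒ᵇ-intro λ j∼i → not-intro λ j<i → below j j∼i (⌊⌋-elim _ j<i))

min-elim : {P : PRel n} {i : Fin n} → isPartMin P i ≡ true → i ∼[ P ] i × (∀ j → j ∼[ P ] i → ¬ j < i)
min-elim h = proj₁ (∧-elim h) , λ j j∼i j<i →
  not-elim (⇒ᵇ-elim (allᵇ-elim (proj₂ (∧-elim h)) j) j∼i) (⌊⌋-intro _ j<i)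

unique-min : {P : PRel n} → IsPP P → ∀ {j} → j ∼[ P ] j →
  ∃ λ m → ∀ i → (isPartMin P i ∧ (i ∼⟨ P ⟩ j)) ≡ (i == m)
unique-min {P = P} pp {j} j∼j with least (λ i → i ∼⟨ P ⟩ j) j j∼j
... | m , m∼j , below = m , λ i → bool-ext (to i) (from i)
  where
  open IsPP pp
  to : ∀ i → (isPartMin P i ∧ (i ∼⟨ P ⟩ j)) ≡ true → (i == m) ≡ true
  to i h with ∧-elim h
  ... | min , i∼j with Fin.<-cmp i m
  ... | tri< i<m _ _ = ⊥-elim (below i i∼j i<m)
  ... | tri≈ _ eq _  = ==-intro eq
  ... | tri> _ _ m<i = ⊥-elim (proj₂ (min-elim {P = P} min) m (∼-trans m∼j (∼-sym i∼j)) m<i)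
  from : ∀ i → (i == m) ≡ true → (isPartMin P i ∧ (i ∼⟨ P ⟩ j)) ≡ true
  from i h with ==-elim {i = i} h
  ... | ≡.refl = ∧-intro (min-intro {P = P} (∼-reflˡ m∼j) λ k k∼m → below k (∼-trans k∼m m∼j)) m∼j

-- Removing a point from a partial partition, and adding one

remove : Fin n → PRel n → PRel n
remove x P = fromRel λ i j → (i ∼⟨ P ⟩ j) ∧ (not (i == x) ∧ not (j == x))

-- Here r is meant to be the indicator of the part that x joins; the constant `false` makes x a part
-- of its own.
add : Fin n → (Fin n → Bool) → PRel n → PRel n
add x r P = fromRel λ i j →
  if i == x then (j == x) ∨ r j else (if j == x then r i else i ∼⟨ P ⟩ j)

module _ {x : Fin n} {P : PRel n} where

  remove-intro : ∀ {i j} → i ∼[ P ] j → i ≢ x → j ≢ x → i ∼[ remove x P ] j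
  remove-intro {i} {j} h i≢x j≢x = ≡.trans (∼-fromRel _ i j)
    (∧-intro h (∧-intro (not-intro (i≢x ∘ ==-elim)) (not-intro (j≢x ∘ ==-elim))))

  remove-elim : ∀ {i j} → i ∼[ remove x P ] j → i ∼[ P ] j × i ≢ x × j ≢ x
  remove-elim {i} {j} h with ∧-elim (≡.trans (≡.sym (∼-fromRel _ i j)) h)
  ... | i∼j , k with ∧-elim {not (i == x)} k
  ... | k₁ , k₂ = i∼j , not-elim k₁ ∘ ==-intro , not-elim k₂ ∘ ==-intro

  remove-uncovers : ¬ (x ∼[ remove x P ] x)
  remove-uncovers h = proj₁ (proj₂ (remove-elim h)) ≡.refl

  remove-isPP : IsPP P → IsPP (remove x P)
  remove-isPP pp = record
    { ∼-sym   = λ h → let i∼j , i≢x , j≢x = remove-elim h in remove-intro (∼-sym i∼j) j≢x i≢x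
    ; ∼-trans = λ h k → let i∼j , i≢x , _ = remove-elim h; j∼k , _ , k≢x = remove-elim k
                        in remove-intro (∼-trans i∼j j∼k) i≢x k≢x
    }
    where open IsPP pp

module _ {x : Fin n} {r : Fin n → Bool} {P : PRel n} where

  add-xx : x ∼[ add x r P ] x
  add-xx = ≡.trans (∼-fromRel _ x x)
    (≡.trans (if-true (==-intro {i = x} ≡.refl)) (≡.cong (_∨ r x) (==-intro {i = x} ≡.refl)))

  add-xj : ∀ {j} → j ≢ x → (x ∼⟨ add x r P ⟩ j) ≡ r j
  add-xj {j} j≢x = ≡.trans (∼-fromRel _ x j)
    (≡.trans (if-true (==-intro {i = x} ≡.refl)) (≡.cong (_∨ r j) (==-false j≢x)))

  add-ix : ∀ {i} → i ≢ x → (i ∼⟨ add x r P ⟩ x) ≡ r i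
  add-ix {i} i≢x = ≡.trans (∼-fromRel _ i x) (≡.trans (if-false (==-false i≢x)) (if-true (==-intro {i = x} ≡.refl)))

  add-ij : ∀ {i j} → i ≢ x → j ≢ x → (i ∼⟨ add x r P ⟩ j) ≡ (i ∼⟨ P ⟩ j)
  add-ij {i} {j} i≢x j≢x =
    ≡.trans (∼-fromRel _ i j) (≡.trans (if-false (==-false i≢x)) (if-false (==-false j≢x)))

  module _ (pp : IsPP P) (together : ∀ {i j} → r i ≡ true → r j ≡ true → i ∼[ P ] j)
           (closed : ∀ {i j} → r i ≡ true → i ∼[ P ] j → r j ≡ true) where
    open IsPP pp

    -- Together, `together` and `closed` say that r is empty or a whole part of P, which is what
    -- transitivity through x requires.
    add-isPP : IsPP (add x r P)
    add-isPP = record { ∼-sym = λ {i} {j} → s i j ; ∼-trans = λ {i} {j} {k} → t i j k }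
      where
      Q = add x r P
      s : ∀ i j → i ∼[ Q ] j → j ∼[ Q ] i
      s i j h with i Fin.≟ x | j Fin.≟ x
      ... | yes ≡.refl | yes ≡.refl = h
      ... | yes ≡.refl | no j≢x   = ≡.trans (add-ix j≢x) (≡.trans (≡.sym (add-xj j≢x)) h)
      ... | no i≢x   | yes ≡.refl = ≡.trans (add-xj i≢x) (≡.trans (≡.sym (add-ix i≢x)) h)
      ... | no i≢x   | no j≢x   = ≡.trans (add-ij j≢x i≢x) (∼-sym (≡.trans (≡.sym (add-ij i≢x j≢x)) h))
      t : ∀ i j k → i ∼[ Q ] j → j ∼[ Q ] k → i ∼[ Q ] k
      t i j k u v with i Fin.≟ x | j Fin.≟ x | k Fin.≟ x
      ... | yes ≡.refl | yes ≡.refl | _ = v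
      ... | yes ≡.refl | no _     | yes ≡.refl = add-xx
      ... | no i≢x   | yes ≡.refl | yes ≡.refl = u
      ... | yes ≡.refl | no j≢x   | no k≢x = ≡.trans (add-xj k≢x)
              (closed (≡.trans (≡.sym (add-xj j≢x)) u) (≡.trans (≡.sym (add-ij j≢x k≢x)) v))
      ... | no i≢x   | yes ≡.refl | no k≢x = ≡.trans (add-ij i≢x k≢x)
              (together (≡.trans (≡.sym (add-ix i≢x)) u) (≡.trans (≡.sym (add-xj k≢x)) v))
      ... | no i≢x   | no j≢x   | yes ≡.refl = ≡.trans (add-ix i≢x)
              (closed (≡.trans (≡.sym (add-ix j≢x)) v) (∼-sym (≡.trans (≡.sym (add-ij i≢x j≢x)) u)))
      ... | no i≢x   | no j≢x   | no k≢x = ≡.trans (add-ij i≢x k≢x)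
              (∼-trans (≡.trans (≡.sym (add-ij i≢x j≢x)) u) (≡.trans (≡.sym (add-ij j≢x k≢x)) v))

  remove-add : IsPP P → ¬ (x ∼[ P ] x) → remove x (add x r P) ≡ P
  remove-add pp x≁x = PRel-ext λ i j → bool-ext
    (λ h → let u , i≢x , j≢x = remove-elim {P = add x r P} h in ≡.trans (≡.sym (add-ij i≢x j≢x)) u)
    (λ h → let i≢x = λ { ≡.refl → x≁x (∼-reflˡ h) }; j≢x = λ { ≡.refl → x≁x (∼-reflʳ h) }
           in remove-intro {P = add x r P} (≡.trans (add-ij i≢x j≢x) h) i≢x j≢x)
    where open IsPP pp

-- Agreement of r with P is asked only away from x: in the applications r is read off `remove x P`,
-- where x is uncovered, and `add` restores the diagonal entry by itself.
add-remove : {x : Fin n} {r : Fin n → Bool} {P : PRel n} → IsPP P → x ∼[ P ] x →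
  (∀ i → i ≢ x → r i ≡ (x ∼⟨ P ⟩ i)) → add x r (remove x P) ≡ P
add-remove {x = x} {r} {P} pp x∼x r≡ = PRel-ext eq
  where
  open IsPP pp
  eq : ∀ i j → (i ∼⟨ add x r (remove x P) ⟩ j) ≡ (i ∼⟨ P ⟩ j)
  eq i j with i Fin.≟ x | j Fin.≟ x
  ... | yes ≡.refl | yes ≡.refl = ≡.trans (add-xx {P = remove x P}) (≡.sym x∼x)
  ... | yes ≡.refl | no j≢x   = ≡.trans (add-xj {P = remove x P} j≢x) (r≡ j j≢x)
  ... | no i≢x   | yes ≡.refl = ≡.trans (add-ix {P = remove x P} i≢x)
                                (≡.trans (r≡ i i≢x) (bool-ext ∼-sym ∼-sym))
  ... | no i≢x   | no j≢x   = ≡.trans (add-ij {P = remove x P} i≢x j≢x)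
                                (bool-ext (proj₁ ∘ remove-elim {P = P}) (λ h → remove-intro {P = P} h i≢x j≢x))

isAlone : Fin n → PRel n → Bool
isAlone {n} x P = (x ∼⟨ P ⟩ x) ∧ allᵇ (λ j → (x ∼⟨ P ⟩ j) ⇒ᵇ (j == x)) (allFin n)

alone-intro : {x : Fin n} {P : PRel n} → x ∼[ P ] x → (∀ j → x ∼[ P ] j → j ≡ x) → isAlone x P ≡ true
alone-intro h only = ∧-intro h (allᵇ-intro λ j → ⇒ᵇ-intro λ k → ==-intro (only j k))

alone-elim : {x : Fin n} {P : PRel n} → isAlone x P ≡ true → x ∼[ P ] x × (∀ j → x ∼[ P ] j → j ≡ x)
alone-elim h = proj₁ (∧-elim h) , λ j k → ==-elim (⇒ᵇ-elim (allᵇ-elim (proj₂ (∧-elim h)) j) k)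

-- Finite sums and products

-- The same manipulations serve sums and products in the ring and counts in ℕ, hence an arbitrary
-- commutative monoid; `big` unfolds to `∑` or `∏` there.
module BigOp {c ℓ} (M : CommutativeMonoid c ℓ) where
  open CommutativeMonoid M
  open import Algebra.Properties.CommutativeSemigroup commutativeSemigroup using (interchange)
  open import Relation.Binary.Reasoning.Setoid setoid

  big : List X → (X → Carrier) → Carrier
  big xs f = List.foldr (λ x s → f x ∙ s) ε xs

  -- An absent term is the neutral element: 0 in a sum, but 1 in a product. Guards replace filters
  -- so that all sums run over the same list.
  when : Bool → Carrier → Carrier
  when b g = if b then g else ε

  when-cong : ∀ b {g h} → (b ≡ true → g ≈ h) → when b g ≈ when b h
  when-cong true  eq = eq ≡.refl
  when-cong false _  = refl

  when-ε : ∀ b → when b ε ≈ ε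
  when-ε true  = refl
  when-ε false = refl

  when-∧ : ∀ b d {g} → when (b ∧ d) g ≈ when b (when d g)
  when-∧ true  d = refl
  when-∧ false d = refl

  when-swap : ∀ b d {g} → when b (when d g) ≈ when d (when b g)
  when-swap true  d     = refl
  when-swap false true  = refl
  when-swap false false = refl

  when-∙ : ∀ b {g h} → when b (g ∙ h) ≈ when b g ∙ when b h
  when-∙ true  = refl
  when-∙ false = sym (identityˡ ε)

  when-split : ∀ b {g} → when b g ∙ when (not b) g ≈ g
  when-split true  = identityʳ _
  when-split false = identityˡ _

  when-∨ : ∀ b d {g} → (b ≡ true → d ≡ true → ⊥) → when (b ∨ d) g ≈ when b g ∙ when d g
  when-∨ true  true  disj = ⊥-elim (disj ≡.refl ≡.refl)
  when-∨ true  false disj = sym (identityʳ _)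
  when-∨ false d     disj = sym (identityˡ _)

  when-≡ : ∀ {b d g} → b ≡ d → when b g ≈ when d g
  when-≡ ≡.refl = refl

  when-true : ∀ {b g} → b ≡ true → when b g ≈ g
  when-true ≡.refl = refl

  when-false : ∀ {b g} → ¬ (b ≡ true) → when b g ≈ ε
  when-false {true}  h = ⊥-elim (h ≡.refl)
  when-false {false} h = refl

  big-cong : (xs : List X) {f g : X → Carrier} → (∀ x → f x ≈ g x) → big xs f ≈ big xs g
  big-cong []       eq = refl
  big-cong (x ∷ xs) eq = ∙-cong (eq x) (big-cong xs eq)

  big-ε : (xs : List X) → big xs (λ _ → ε) ≈ ε
  big-ε []       = refl
  big-ε (x ∷ xs) = trans (identityˡ _) (big-ε xs)

  big-∙ : (xs : List X) {f g : X → Carrier} → big xs (λ x → f x ∙ g x) ≈ big xs f ∙ big xs g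
  big-∙ []       = sym (identityˡ ε)
  big-∙ (x ∷ xs) = trans (∙-congˡ (big-∙ xs)) (interchange _ _ _ _)

  big-swap : (xs : List X) (ys : List Y) {f : X → Y → Carrier} →
    big xs (λ x → big ys (f x)) ≈ big ys (λ y → big xs (λ x → f x y))
  big-swap []       ys = sym (big-ε ys)
  big-swap (x ∷ xs) ys = trans (∙-congˡ (big-swap xs ys)) (sym (big-∙ ys))

  big-++ : (xs ys : List X) {f : X → Carrier} → big (xs ++ ys) f ≈ big xs f ∙ big ys f
  big-++ []       ys = sym (identityˡ _)
  big-++ (x ∷ xs) ys = trans (∙-congˡ (big-++ xs ys)) (sym (assoc _ _ _))

  big-map : (g : X → Y) (xs : List X) {f : Y → Carrier} → big (List.map g xs) f ≈ big xs (f ∘ g)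
  big-map g []       = refl
  big-map g (x ∷ xs) = ∙-congˡ (big-map g xs)

  big-concatMap : (g : X → List Y) (xs : List X) {f : Y → Carrier} →
    big (concatMap g xs) f ≈ big xs (λ x → big (g x) f)
  big-concatMap g []       = refl
  big-concatMap g (x ∷ xs) = trans (big-++ (g x) _) (∙-congˡ (big-concatMap g xs))

  big-filter : (p : X → Bool) (xs : List X) {f : X → Carrier} →
    big (filterᵇ p xs) f ≈ big xs (λ x → when (p x) (f x))
  big-filter p []       = refl
  big-filter p (x ∷ xs) with p x
  ... | true  = ∙-congˡ (big-filter p xs)
  ... | false = trans (big-filter p xs) (sym (identityˡ _))

  big-when : ∀ b (xs : List X) {f : X → Carrier} → big xs (λ x → when b (f x)) ≈ when b (big xs f)
  big-when true  xs = refl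
  big-when false xs = big-ε xs

  big-allFin-suc : {f : Fin (suc n) → Carrier} →
    big (allFin (suc n)) f ≈ f zero ∙ big (allFin n) (f ∘ suc)
  big-allFin-suc {n} {f} = ∙-congˡ (begin
    big (List.tabulate suc) f           ≡⟨ ≡.cong (λ l → big l f) (List.map-tabulate id suc) ⟨
    big (List.map suc (allFin n)) f     ≈⟨ big-map suc (allFin n) ⟩
    big (allFin n) (f ∘ suc)            ∎)

  -- xs lists every element of X exactly once, as seen by sums.
  Enumerates : DecidableEquality X → List X → Set _
  Enumerates _≟_ xs = ∀ y g → big xs (λ x → when ⌊ x ≟ y ⌋ g) ≈ g

  enum-δ : {_≟_ : DecidableEquality X} {xs : List X} → Enumerates _≟_ xs →
    (f : X → Carrier) → ∀ y → big xs (λ x → when ⌊ x ≟ y ⌋ (f x)) ≈ f y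
  enum-δ {_≟_ = _≟_} {xs} enum f y = trans
    (big-cong xs λ x → when-cong ⌊ x ≟ y ⌋ λ x≡y → reflexive (≡.cong f (⌊⌋-elim (x ≟ y) x≡y)))
    (enum y (f y))

  enum-Bool : Enumerates Bool._≟_ (true ∷ false ∷ [])
  enum-Bool true  g = trans (∙-congˡ (identityˡ ε)) (identityʳ g)
  enum-Bool false g = trans (identityˡ _) (identityʳ g)

  enum-allFin : Enumerates Fin._≟_ (allFin n)
  enum-allFin {suc n} zero    g = begin
    big (allFin (suc n)) (λ x → when (x == zero) g)            ≈⟨ big-allFin-suc {n} {λ x → when (x == zero) g} ⟩
    g ∙ big (allFin n) (λ x → when (suc x == zero) g)          ≈⟨ ∙-congˡ (big-ε (allFin n)) ⟩
    g ∙ ε                                                      ≈⟨ identityʳ g ⟩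
    g                                                          ∎
  enum-allFin {suc n} (suc y) g = begin
    big (allFin (suc n)) (λ x → when (x == suc y) g)           ≈⟨ big-allFin-suc {n} {λ x → when (x == suc y) g} ⟩
    ε ∙ big (allFin n) (λ x → when (suc x == suc y) g)         ≈⟨ identityˡ _ ⟩
    big (allFin n) (λ x → when (suc x == suc y) g)
      ≈⟨ big-cong (allFin n) (λ x → when-≡ {suc x == suc y} {x == y} (bool-ext
           (==-intro ∘ Fin.suc-injective ∘ ==-elim {i = suc x}) (==-intro ∘ ≡.cong suc ∘ ==-elim {i = x}))) ⟩
    big (allFin n) (λ x → when (x == y) g)                     ≈⟨ enum-allFin y g ⟩
    g                                                          ∎

  enum-allVecsOver : {_≟_ : DecidableEquality X} {xs : List X} → Enumerates _≟_ xs →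
    ∀ m → Enumerates (Vec.≡-dec _≟_) (allVecsOver xs m)
  enum-allVecsOver enum zero Vec.[] g = identityʳ g
  enum-allVecsOver {_≟_ = _≟_} {xs} enum (suc m) (y Vec.∷ w) g = begin
    big (concatMap (λ v → List.map (Vec._∷ v) xs) vs) δ
      ≈⟨ big-concatMap _ vs ⟩
    big vs (λ v → big (List.map (Vec._∷ v) xs) δ)
      ≈⟨ big-cong vs (λ v → trans (big-map _ xs) (trans
           (big-cong xs (λ x → trans (when-≡ (eq x v)) (when-∧ ⌊ v ≟ᵛ w ⌋ ⌊ x ≟ y ⌋)))
           (big-when _ xs))) ⟩
    big vs (λ v → when ⌊ v ≟ᵛ w ⌋ (big xs (λ x → when ⌊ x ≟ y ⌋ g)))
      ≈⟨ enum-allVecsOver enum m w _ ⟩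
    big xs (λ x → when ⌊ x ≟ y ⌋ g)
      ≈⟨ enum y g ⟩
    g ∎
    where
    vs = allVecsOver xs m
    _≟ᵛ_ : ∀ {k} → DecidableEquality (Vec _ k)
    _≟ᵛ_ = Vec.≡-dec _≟_
    δ = λ u → when ⌊ u ≟ᵛ (y Vec.∷ w) ⌋ g
    eq : ∀ x v → ⌊ (x Vec.∷ v) ≟ᵛ (y Vec.∷ w) ⌋ ≡ (⌊ v ≟ᵛ w ⌋ ∧ ⌊ x ≟ y ⌋)
    eq x v = bool-ext
      (λ h → let x≡y , v≡w = Vec.∷-injective (⌊⌋-elim (_ ≟ᵛ _) h)
             in ∧-intro (⌊⌋-intro (v ≟ᵛ w) v≡w) (⌊⌋-intro (x ≟ y) x≡y))
      (λ h → let v≡w , x≡y = ∧-elim h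
             in ⌊⌋-intro (_ ≟ᵛ _) (≡.cong₂ Vec._∷_ (⌊⌋-elim (x ≟ y) x≡y) (⌊⌋-elim (v ≟ᵛ w) v≡w)))

  -- A change of variables that leaves the list alone. Write f (φ x) as a sum over y against the
  -- indicator of y = φ x. The guards p x and y = φ x hold together exactly when x = ψ y and q y do,
  -- so after exchanging the sums the inner sum over x collapses.
  reindex : {_≟_ : DecidableEquality X} {xs : List X} → Enumerates _≟_ xs →
    (p q : X → Bool) (φ ψ : X → X) →
    (∀ x → p x ≡ true → q (φ x) ≡ true × ψ (φ x) ≡ x) →
    (∀ y → q y ≡ true → p (ψ y) ≡ true × φ (ψ y) ≡ y) →
    (f : X → Carrier) →
    big xs (λ x → when (p x) (f (φ x))) ≈ big xs (λ y → when (q y) (f y))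
  reindex {_≟_ = _≟_} {xs} enum p q φ ψ to from f = begin
    big xs (λ x → when (p x) (f (φ x)))
      ≈⟨ big-cong xs (λ x → when-cong (p x) (λ _ → enum-δ {_≟_ = _≟_} {xs} enum f (φ x))) ⟨
    big xs (λ x → when (p x) (big xs (λ y → when ⌊ y ≟ φ x ⌋ (f y))))
      ≈⟨ big-cong xs (λ x → big-when (p x) xs) ⟨
    big xs (λ x → big xs (λ y → when (p x) (when ⌊ y ≟ φ x ⌋ (f y))))
      ≈⟨ big-cong xs (λ x → big-cong xs (λ y → trans (sym (when-∧ (p x) _))
           (trans (when-≡ (eq x y)) (when-∧ ⌊ x ≟ ψ y ⌋ _)))) ⟩
    big xs (λ x → big xs (λ y → when ⌊ x ≟ ψ y ⌋ (when (q y) (f y))))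
      ≈⟨ big-swap xs xs ⟩
    big xs (λ y → big xs (λ x → when ⌊ x ≟ ψ y ⌋ (when (q y) (f y))))
      ≈⟨ big-cong xs (λ y → enum (ψ y) _) ⟩
    big xs (λ y → when (q y) (f y)) ∎
    where
    eq : ∀ x y → (p x ∧ ⌊ y ≟ φ x ⌋) ≡ (⌊ x ≟ ψ y ⌋ ∧ q y)
    eq x y = bool-ext
      (λ h → let px , y≡ = ∧-elim h; qφ , ψφ = to x px; e = ⌊⌋-elim (y ≟ φ x) y≡
             in ∧-intro (⌊⌋-intro (x ≟ ψ y) (≡.trans (≡.sym ψφ) (≡.cong ψ (≡.sym e))))
                        (≡.trans (≡.cong q e) qφ))
      (λ h → let x≡ , qy = ∧-elim h; pψ , φψ = from y qy; e = ⌊⌋-elim (x ≟ ψ y) x≡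
             in ∧-intro (≡.trans (≡.cong p e) pψ)
                        (⌊⌋-intro (y ≟ φ x) (≡.trans (≡.sym φψ) (≡.cong φ (≡.sym e)))))

  big-single : {p : Fin n → Bool} (m : Fin n) → (∀ i → p i ≡ (i == m)) →
    ∀ g → big (allFin n) (λ i → when (p i) g) ≈ g
  big-single m eq g = trans (big-cong (allFin _) λ i → when-≡ (eq i)) (enum-allFin m g)

  -- Part minima act as representatives of parts: a covered j is related to exactly one of them, an
  -- uncovered j to none. Counting parts, computing `sgnPP` and locating the part that x joins all
  -- rest on this.
  big-min : {P : PRel n} → IsPP P → ∀ j g →
    big (allFin n) (λ i → when (isPartMin P i ∧ (i ∼⟨ P ⟩ j)) g) ≈ when (j ∼⟨ P ⟩ j) g
  big-min {n} {P} pp j g with j ∼⟨ P ⟩ j in j∼j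
  ... | true  = let m , eq = unique-min pp j∼j in big-single m eq g
  ... | false = trans (big-cong (allFin n) λ i → when-false λ h → true≢false (∼-reflʳ (proj₂ (∧-elim {isPartMin P i} h))) j∼j)
                      (big-ε (allFin n))
    where open IsPP pp

-- The number of parts before and after removing a point

open BigOp ℕ.+-0-commutativeMonoid using () renaming
  ( big to sum; when to whenℕ; when-≡ to whenℕ-≡; when-false to whenℕ-false; when-true to whenℕ-true
  ; when-∧ to whenℕ-∧; when-swap to whenℕ-swap; when-∨ to whenℕ-∨
  ; when-cong to whenℕ-cong; big-cong to sum-cong; big-∙ to sum-+; big-swap to sum-swap; big-when to sum-when
  ; big-min to sum-min; big-ε to sum-0; enum-allFin to sum-enum-allFin)

length-filter : (p : X → Bool) (xs : List X) → length (filterᵇ p xs) ≡ sum xs (λ x → whenℕ (p x) 1)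
length-filter p []       = ≡.refl
length-filter p (x ∷ xs) with p x
... | true  = ≡.cong suc (length-filter p xs)
... | false = length-filter p xs

numParts-sum : (P : PRel n) → numParts P ≡ sum (allFin n) (λ i → whenℕ (isPartMin P i) 1)
numParts-sum {n} P = ≡.trans (List.length-map (partOf P) (filterᵇ (isPartMin P) (allFin n)))
  (length-filter (isPartMin P) (allFin n))

-- Both sides count the pairs of equivalent part minima (i of P, j of remove x P).
numParts-remove : {x y : Fin n} {P : PRel n} → IsPP P → x ∼[ P ] y → y ≢ x →
  numParts (remove x P) ≡ numParts P
numParts-remove {n} {x} {y} {P} pp x∼y y≢x = begin
  numParts P′
    ≡⟨ numParts-sum P′ ⟩
  sum F (λ j → whenℕ (isPartMin P′ j) 1)
    ≡⟨ sum-cong F (λ j → ≡.trans (whenℕ-∧-absorb j) (≡.cong (whenℕ (isPartMin P′ j)) (≡.sym (sum-min pp j 1)))) ⟩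
  sum F (λ j → whenℕ (isPartMin P′ j) (sum F (λ i → whenℕ (isPartMin P i ∧ (i ∼⟨ P ⟩ j)) 1)))
    ≡⟨ sum-cong F (λ j → sum-when (isPartMin P′ j) F) ⟨
  sum F (λ j → sum F (λ i → whenℕ (isPartMin P′ j) (whenℕ (isPartMin P i ∧ (i ∼⟨ P ⟩ j)) 1)))
    ≡⟨ sum-swap F F ⟩
  sum F (λ i → sum F (λ j → whenℕ (isPartMin P′ j) (whenℕ (isPartMin P i ∧ (i ∼⟨ P ⟩ j)) 1)))
    ≡⟨ sum-cong F rows ⟩
  sum F (λ i → whenℕ (isPartMin P i) 1)
    ≡⟨ numParts-sum P ⟨
  numParts P ∎
  where
  open ≡.≡-Reasoning
  open IsPP pp
  F = allFin n
  P′ = remove x P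
  pp′ = remove-isPP pp
  whenℕ-∧-absorb : ∀ j → whenℕ (isPartMin P′ j) 1 ≡ whenℕ (isPartMin P′ j) (whenℕ (j ∼⟨ P ⟩ j) 1)
  whenℕ-∧-absorb j = whenℕ-cong (isPartMin P′ j) λ h →
    ≡.sym (whenℕ-true {j ∼⟨ P ⟩ j} (proj₁ (remove-elim {P = P} (proj₁ (min-elim {P = P′} h)))))
  -- The minimum of a part may be x itself; that part then survives in `remove x P` through y.
  companion : ∀ i → i ∼[ P ] i → ∃ λ i′ → i′ ∼[ P ] i × i′ ≢ x
  companion i i∼i with i Fin.≟ x
  ... | yes ≡.refl = y , ∼-sym x∼y , y≢x
  ... | no i≢x     = i , i∼i , i≢x
  row : ∀ i → isPartMin P i ≡ true → sum F (λ j → whenℕ (isPartMin P′ j ∧ (i ∼⟨ P ⟩ j)) 1) ≡ 1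
  row i min with companion i (proj₁ (min-elim {P = P} min))
  ... | i′ , i′∼i , i′≢x = ≡.trans
    (sum-cong F λ j → whenℕ-≡ (bool-ext
      (λ h → let mj , i∼j = ∧-elim {isPartMin P′ j} h
             in ∧-intro mj (∼-sym′ (remove-intro {P = P} (∼-trans i′∼i i∼j) i′≢x
                  (proj₁ (proj₂ (remove-elim {P = P} (proj₁ (min-elim {P = P′} mj))))))))
      (λ h → let mj , j∼i′ = ∧-elim {isPartMin P′ j} h
             in ∧-intro mj (∼-sym (∼-trans (proj₁ (remove-elim {P = P} j∼i′)) i′∼i)))))
    (≡.trans (sum-min pp′ i′ 1) (whenℕ-true (remove-intro {P = P} (∼-reflˡ i′∼i) i′≢x i′≢x)))
    where open IsPP pp′ using () renaming (∼-sym to ∼-sym′)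
  rows : ∀ i → sum F (λ j → whenℕ (isPartMin P′ j) (whenℕ (isPartMin P i ∧ (i ∼⟨ P ⟩ j)) 1))
             ≡ whenℕ (isPartMin P i) 1
  rows i = begin
    sum F (λ j → whenℕ (isPartMin P′ j) (whenℕ (isPartMin P i ∧ (i ∼⟨ P ⟩ j)) 1))
      ≡⟨ sum-cong F (λ j → ≡.trans (≡.cong (whenℕ (isPartMin P′ j)) (whenℕ-∧ (isPartMin P i) (i ∼⟨ P ⟩ j)))
           (≡.trans (whenℕ-swap (isPartMin P′ j) (isPartMin P i))
                    (≡.cong (whenℕ (isPartMin P i)) (≡.sym (whenℕ-∧ (isPartMin P′ j) (i ∼⟨ P ⟩ j)))))) ⟩
    sum F (λ j → whenℕ (isPartMin P i) (whenℕ (isPartMin P′ j ∧ (i ∼⟨ P ⟩ j)) 1))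
      ≡⟨ sum-when (isPartMin P i) F ⟩
    whenℕ (isPartMin P i) (sum F (λ j → whenℕ (isPartMin P′ j ∧ (i ∼⟨ P ⟩ j)) 1))
      ≡⟨ whenℕ-cong (isPartMin P i) (row i) ⟩
    whenℕ (isPartMin P i) 1 ∎

-- No other point is related to x, so the minima of P are x together with the unchanged minima of
-- `remove x P`.
numParts-alone : {x : Fin n} {P : PRel n} → IsPP P → isAlone x P ≡ true →
  numParts P ≡ suc (numParts (remove x P))
numParts-alone {n} {x} {P} pp alone = begin
  numParts P
    ≡⟨ numParts-sum P ⟩
  sum F (λ i → whenℕ (isPartMin P i) 1)
    ≡⟨ sum-cong F (λ i → ≡.trans (whenℕ-≡ (mins i)) (whenℕ-∨ (i == x) (isPartMin P′ i) (disj i))) ⟩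
  sum F (λ i → whenℕ (i == x) 1 ℕ.+ whenℕ (isPartMin P′ i) 1)
    ≡⟨ sum-+ F ⟩
  sum F (λ i → whenℕ (i == x) 1) ℕ.+ sum F (λ i → whenℕ (isPartMin P′ i) 1)
    ≡⟨ ≡.cong₂ ℕ._+_ (sum-enum-allFin x 1) (≡.sym (numParts-sum P′)) ⟩
  suc (numParts P′) ∎
  where
  open ≡.≡-Reasoning
  open IsPP pp
  F = allFin n
  P′ = remove x P
  x∼x = proj₁ (alone-elim {P = P} alone)
  only = proj₂ (alone-elim {P = P} alone)
  disj : ∀ i → (i == x) ≡ true → isPartMin P′ i ≡ true → ⊥
  disj i e h = proj₁ (proj₂ (remove-elim {P = P} (proj₁ (min-elim {P = P′} h)))) (==-elim e)
  mins : ∀ i → isPartMin P i ≡ ((i == x) ∨ isPartMin P′ i)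
  mins i with i Fin.≟ x
  ... | yes ≡.refl = min-intro {P = P} x∼x λ j j∼x j<x → Fin.<-irrefl (only j (∼-sym j∼x)) j<x
  ... | no i≢x = bool-ext
    (λ h → let i∼i , below = min-elim {P = P} h
           in min-intro {P = P′} (remove-intro {P = P} i∼i i≢x i≢x) λ j j∼i → below j (proj₁ (remove-elim {P = P} j∼i)))
    (λ h → let i∼i , below = min-elim {P = P′} h
           in min-intro {P = P} (proj₁ (remove-elim {P = P} i∼i)) λ j j∼i →
                below j (remove-intro {P = P} j∼i (λ { ≡.refl → i≢x (only i j∼i) }) i≢x))

-- The weight of a partial partition

allRels : ∀ n → List (PRel n)
allRels n = allVecsOver (allVecsOver (true ∷ false ∷ []) n) n

module Weights {c ℓ} (R : CommutativeRing c ℓ) where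
  open CommutativeRing R hiding (zero)
  open RingOps R
  open BigOp +-commutativeMonoid public
  module Π = BigOp *-commutativeMonoid
  open import Algebra.Properties.Ring ring
    using (-1*x≈-x; -‿distribˡ-*; -‿distribʳ-*; -‿involutive; -0#≈0#)
  open import Algebra.Properties.CommutativeSemigroup *-commutativeSemigroup using (x∙yz≈y∙xz)
  open import Relation.Binary.Reasoning.Setoid setoid

  enumRels : Enumerates (Vec.≡-dec (Vec.≡-dec Bool._≟_)) (allRels n)
  enumRels {n} = enum-allVecsOver {_≟_ = Vec.≡-dec Bool._≟_} (enum-allVecsOver {_≟_ = Bool._≟_} enum-Bool n) n

  ∑-*ˡ : ∀ {a} {X : Set a} (xs : List X) {f : X → Carrier} {k} → ∑ xs (λ x → k * f x) ≈ k * ∑ xs f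
  ∑-*ˡ []       = sym (zeroʳ _)
  ∑-*ˡ (x ∷ xs) = trans (+-congˡ (∑-*ˡ xs)) (sym (distribˡ _ _ _))

  ∑-neg : ∀ {a} {X : Set a} (xs : List X) {f : X → Carrier} → ∑ xs (λ x → - f x) ≈ - ∑ xs f
  ∑-neg xs = trans (big-cong xs λ _ → sym (-1*x≈-x _)) (trans (∑-*ˡ xs) (-1*x≈-x _))

  when-neg : ∀ b {g} → when b (- g) ≈ - when b g
  when-neg true  = refl
  when-neg false = sym -0#≈0#

  when-*ˡ : ∀ b {k g} → k * when b g ≈ when b (k * g)
  when-*ˡ true  = refl
  when-*ˡ false = zeroʳ _

  ⟦+⟧ : ∀ k m → ⟦ k ℕ.+ m ⟧ ≈ ⟦ k ⟧ + ⟦ m ⟧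
  ⟦+⟧ zero    m = sym (+-identityˡ _)
  ⟦+⟧ (suc k) m = trans (+-congˡ (⟦+⟧ k m)) (sym (+-assoc _ _ _))

  ⟦*⟧ : ∀ k m → ⟦ k ℕ.* m ⟧ ≈ ⟦ k ⟧ * ⟦ m ⟧
  ⟦*⟧ zero    m = sym (zeroˡ _)
  ⟦*⟧ (suc k) m = begin
    ⟦ m ℕ.+ k ℕ.* m ⟧             ≈⟨ ⟦+⟧ m (k ℕ.* m) ⟩
    ⟦ m ⟧ + ⟦ k ℕ.* m ⟧           ≈⟨ +-cong (sym (*-identityˡ _)) (⟦*⟧ k m) ⟩
    1# * ⟦ m ⟧ + ⟦ k ⟧ * ⟦ m ⟧    ≈⟨ distribʳ _ _ _ ⟨
    (1# + ⟦ k ⟧) * ⟦ m ⟧          ∎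

  ∑-when-const : ∀ {a} {X : Set a} (p : X → Bool) (xs : List X) {g} →
    ∑ xs (λ x → when (p x) g) ≈ ⟦ length (filterᵇ p xs) ⟧ * g
  ∑-when-const p []       = sym (zeroˡ _)
  ∑-when-const p (x ∷ xs) with p x
  ... | true  = trans (+-cong (sym (*-identityˡ _)) (∑-when-const p xs)) (sym (distribʳ _ _ _))
  ... | false = trans (+-identityˡ _) (∑-when-const p xs)

  neg1^-filter : ∀ {a} {X : Set a} (p : X → Bool) (xs : List X) →
    neg1^ (length (filterᵇ p xs)) ≈ ∏ xs (λ x → Π.when (p x) (- 1#))
  neg1^-filter p []       = refl
  neg1^-filter p (x ∷ xs) with p x
  ... | true  = *-congˡ (neg1^-filter p xs)
  ... | false = trans (neg1^-filter p xs) (sym (*-identityˡ _))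

  coverSign : PRel n → Carrier
  coverSign {n} P = ∏ (allFin n) (λ i → Π.when (i ∼⟨ P ⟩ i) (- 1#))

  signedFact : ℕ → Carrier
  signedFact k = neg1^ k * ⟦ k ! ⟧

  weight : PRel n → Carrier
  weight P = coverSign P * signedFact (numParts P)

  neg1^-numParts : (P : PRel n) → neg1^ (numParts P) ≈ ∏ (allFin n) (λ i → Π.when (isPartMin P i) (- 1#))
  neg1^-numParts {n} P = trans
    (reflexive (≡.cong neg1^ (List.length-map (partOf P) (filterᵇ (isPartMin P) (allFin n)))))
    (neg1^-filter (isPartMin P) (allFin n))

  -- Every covered point lies in exactly one part, that of its part minimum.
  sgnPP-cover : {P : PRel n} → IsPP P → sgnPP P ≈ coverSign P * neg1^ (numParts P)
  sgnPP-cover {n} {P} pp = begin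
    ∏ (List.map (partOf P) (filterᵇ (isPartMin P) F)) (λ S → neg1^ (suc (length S)))
      ≈⟨ Π.big-map (partOf P) (filterᵇ (isPartMin P) F) ⟩
    ∏ (filterᵇ (isPartMin P) F) (λ i → neg1^ (suc (length (partOf P i))))
      ≈⟨ Π.big-filter (isPartMin P) F ⟩
    ∏ F (λ i → Π.when (isPartMin P i) ((- 1#) * neg1^ (length (partOf P i))))
      ≈⟨ Π.big-cong F (λ i → trans (Π.when-∙ (isPartMin P i))
           (*-congˡ (Π.when-cong (isPartMin P i) λ _ → neg1^-filter (λ j → i ∼⟨ P ⟩ j) F))) ⟩
    ∏ F (λ i → Π.when (isPartMin P i) (- 1#) * Π.when (isPartMin P i) (∏ F (λ j → Π.when (i ∼⟨ P ⟩ j) (- 1#))))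
      ≈⟨ Π.big-∙ F ⟩
    ∏ F (λ i → Π.when (isPartMin P i) (- 1#)) * ∏ F (λ i → Π.when (isPartMin P i) (∏ F (λ j → Π.when (i ∼⟨ P ⟩ j) (- 1#))))
      ≈⟨ *-cong (sym (neg1^-numParts P)) cover ⟩
    neg1^ (numParts P) * coverSign P
      ≈⟨ *-comm _ _ ⟩
    coverSign P * neg1^ (numParts P) ∎
    where
    F = allFin n
    cover : ∏ F (λ i → Π.when (isPartMin P i) (∏ F (λ j → Π.when (i ∼⟨ P ⟩ j) (- 1#)))) ≈ coverSign P
    cover = begin
      ∏ F (λ i → Π.when (isPartMin P i) (∏ F (λ j → Π.when (i ∼⟨ P ⟩ j) (- 1#))))
        ≈⟨ Π.big-cong F (λ i → Π.big-when (isPartMin P i) F) ⟨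
      ∏ F (λ i → ∏ F (λ j → Π.when (isPartMin P i) (Π.when (i ∼⟨ P ⟩ j) (- 1#))))
        ≈⟨ Π.big-swap F F ⟩
      ∏ F (λ j → ∏ F (λ i → Π.when (isPartMin P i) (Π.when (i ∼⟨ P ⟩ j) (- 1#))))
        ≈⟨ Π.big-cong F (λ j → Π.big-cong F (λ i → Π.when-∧ (isPartMin P i) (i ∼⟨ P ⟩ j))) ⟨
      ∏ F (λ j → ∏ F (λ i → Π.when (isPartMin P i ∧ (i ∼⟨ P ⟩ j)) (- 1#)))
        ≈⟨ Π.big-cong F (λ j → Π.big-min pp j (- 1#)) ⟩
      coverSign P ∎

  weight-sgnPP : {P : PRel n} → IsPP P → sgnPP P * ⟦ numParts P ! ⟧ ≈ weight P
  weight-sgnPP pp = trans (*-congʳ (sgnPP-cover pp)) (*-assoc _ _ _)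

  coverSign-remove : {x : Fin n} {P : PRel n} → x ∼[ P ] x → coverSign P ≈ - coverSign (remove x P)
  coverSign-remove {n} {x} {P} x∼x = begin
    ∏ F (λ i → Π.when (i ∼⟨ P ⟩ i) (- 1#))
      ≈⟨ Π.big-cong F (λ i → trans (Π.when-≡ (covered i)) (Π.when-∨ (i == x) _ (disjoint i))) ⟩
    ∏ F (λ i → Π.when (i == x) (- 1#) * Π.when (i ∼⟨ P′ ⟩ i) (- 1#))
      ≈⟨ Π.big-∙ F ⟩
    ∏ F (λ i → Π.when (i == x) (- 1#)) * coverSign P′
      ≈⟨ *-congʳ (Π.enum-allFin x (- 1#)) ⟩
    - 1# * coverSign P′
      ≈⟨ -1*x≈-x _ ⟩
    - coverSign P′ ∎
    where
    F = allFin n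
    P′ = remove x P
    disjoint : ∀ i → (i == x) ≡ true → i ∼[ P′ ] i → ⊥
    disjoint i e h = proj₁ (proj₂ (remove-elim {P = P} h)) (==-elim e)
    covered : ∀ i → (i ∼⟨ P ⟩ i) ≡ ((i == x) ∨ (i ∼⟨ P′ ⟩ i))
    covered i with i Fin.≟ x
    ... | yes ≡.refl = x∼x
    ... | no i≢x     = bool-ext (λ h → remove-intro {P = P} h i≢x i≢x) (λ h → proj₁ (remove-elim {P = P} h))

  -- The part of x outlives x because of y, so the number of parts stays the same and only the
  -- parity of the covered points changes.
  weight-attached : {x y : Fin n} {P : PRel n} → IsPP P → x ∼[ P ] y → y ≢ x → weight P ≈ - weight (remove x P)
  weight-attached {x = x} {P = P} pp x∼y y≢x = trans
    (*-cong (coverSign-remove {P = P} (∼-reflˡ x∼y))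
            (reflexive (≡.cong signedFact (≡.sym (numParts-remove pp x∼y y≢x)))))
    (sym (-‿distribˡ-* _ _))
    where open IsPP pp

  weight-alone : {x : Fin n} {P : PRel n} → IsPP P → isAlone x P ≡ true →
    weight P ≈ - coverSign (remove x P) * signedFact (suc (numParts (remove x P)))
  weight-alone {P = P} pp alone = *-cong
    (coverSign-remove {P = P} (proj₁ (alone-elim {P = P} alone)))
    (reflexive (≡.cong signedFact (numParts-alone pp alone)))

  -- The split (k+1)! = k! + k k! isolates the summand that cancels in `weight-fibre` against the k
  -- ways of joining an existing part.
  signedFact-suc : ∀ k → signedFact (suc k) ≈ - (signedFact k + ⟦ k ⟧ * signedFact k)
  signedFact-suc k = begin
    (- 1# * N) * ⟦ k ! ℕ.+ k ℕ.* k ! ⟧      ≈⟨ *-cong (-1*x≈-x N) (trans (⟦+⟧ (k !) _) (+-congˡ (⟦*⟧ k (k !)))) ⟩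
    - N * (⟦ k ! ⟧ + ⟦ k ⟧ * ⟦ k ! ⟧)       ≈⟨ -‿distribˡ-* _ _ ⟨
    - (N * (⟦ k ! ⟧ + ⟦ k ⟧ * ⟦ k ! ⟧))     ≈⟨ -‿cong (trans (distribˡ _ _ _) (+-congˡ (x∙yz≈y∙xz _ _ _))) ⟩
    - (N * ⟦ k ! ⟧ + ⟦ k ⟧ * (N * ⟦ k ! ⟧)) ∎
    where N = neg1^ k

  -- Over the partial partitions P′ leaving x uncovered, the weights of the partitions
  -- obtained by adding x (as a new part, or to one of the k existing ones) sum to weight P′.
  weight-fibre : ∀ k s → - s * signedFact (suc k) + ⟦ k ⟧ * - (s * signedFact k) ≈ s * signedFact k
  weight-fibre k s = begin
    - s * signedFact (suc k) + ⟦ k ⟧ * - (s * f)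
      ≈⟨ +-cong (*-congˡ (signedFact-suc k)) (sym (-‿distribʳ-* _ _)) ⟩
    - s * - (f + ⟦ k ⟧ * f) + - (⟦ k ⟧ * (s * f))
      ≈⟨ +-congʳ (trans (sym (-‿distribˡ-* _ _)) (trans (-‿cong (sym (-‿distribʳ-* _ _))) (-‿involutive _))) ⟩
    s * (f + ⟦ k ⟧ * f) + - (⟦ k ⟧ * (s * f))
      ≈⟨ +-congʳ (trans (distribˡ _ _ _) (+-congˡ (x∙yz≈y∙xz _ _ _))) ⟩
    (s * f + ⟦ k ⟧ * (s * f)) + - (⟦ k ⟧ * (s * f))
      ≈⟨ +-assoc _ _ _ ⟩
    s * f + (⟦ k ⟧ * (s * f) + - (⟦ k ⟧ * (s * f)))
      ≈⟨ trans (+-congˡ (-‿inverseʳ _)) (+-identityʳ _) ⟩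
    s * f ∎
    where f = signedFact k

  -- With a guard on all relations in place of the list `PP n`, bijections between classes of
  -- partial partitions become instances of `reindex` on the one list `allRels n`.
  ∑PP : (PRel n → Carrier) → Carrier
  ∑PP {n} f = ∑ (allRels n) (λ P → when (isPartialPartition P) (f P))

  ∑PP-cong : {f g : PRel n → Carrier} → (∀ P → IsPP P → f P ≈ g P) → ∑PP f ≈ ∑PP g
  ∑PP-cong {n} eq = big-cong (allRels n) λ P → when-cong (isPartialPartition P) (eq P ∘ isPP-elim)

  ∑PP-0 : {f : PRel n → Carrier} → (∀ P → IsPP P → f P ≈ 0#) → ∑PP f ≈ 0#
  ∑PP-0 {n} eq = trans (∑PP-cong eq)
    (trans (big-cong (allRels n) λ P → when-ε (isPartialPartition P)) (big-ε (allRels n)))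

  ∑PP-+ : {f g : PRel n → Carrier} → ∑PP (λ P → f P + g P) ≈ ∑PP f + ∑PP g
  ∑PP-+ {n} = trans (big-cong (allRels n) λ P → when-∙ (isPartialPartition P)) (big-∙ (allRels n))

  ∑PP-neg : {f : PRel n → Carrier} → ∑PP (λ P → - f P) ≈ - ∑PP f
  ∑PP-neg {n} = trans (big-cong (allRels n) λ P → when-neg (isPartialPartition P)) (∑-neg (allRels n))

  ∑PP-swap : ∀ {a} {X : Set a} (xs : List X) {f : PRel n → X → Carrier} →
    ∑PP (λ P → ∑ xs (f P)) ≈ ∑ xs (λ x → ∑PP (λ P → f P x))
  ∑PP-swap {n} xs = trans
    (big-cong (allRels n) λ P → sym (big-when (isPartialPartition P) xs)) (big-swap (allRels n) xs)

  ∑PP-reindex : (p q : PRel n → Bool) (φ ψ : PRel n → PRel n) →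
    (∀ P → IsPP P → p P ≡ true → IsPP (φ P) × q (φ P) ≡ true × ψ (φ P) ≡ P) →
    (∀ P → IsPP P → q P ≡ true → IsPP (ψ P) × p (ψ P) ≡ true × φ (ψ P) ≡ P) →
    (f : PRel n → Carrier) → ∑PP (λ P → when (p P) (f (φ P))) ≈ ∑PP (λ P → when (q P) (f P))
  ∑PP-reindex {n} p q φ ψ to from f = begin
    ∑PP (λ P → when (p P) (f (φ P)))
      ≈⟨ big-cong (allRels n) (λ P → when-∧ (isPartialPartition P) (p P)) ⟨
    ∑ (allRels n) (λ P → when (isPartialPartition P ∧ p P) (f (φ P)))
      ≈⟨ reindex {xs = allRels n} enumRels _ _ φ ψ (λ P → lift p q φ ψ P (to P)) (λ P → lift q p ψ φ P (from P)) f ⟩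
    ∑ (allRels n) (λ P → when (isPartialPartition P ∧ q P) (f P))
      ≈⟨ big-cong (allRels n) (λ P → when-∧ (isPartialPartition P) (q P)) ⟩
    ∑PP (λ P → when (q P) (f P)) ∎
    where
    lift : ∀ (p q : PRel n → Bool) (φ ψ : PRel n → PRel n) P →
      (IsPP P → p P ≡ true → IsPP (φ P) × q (φ P) ≡ true × ψ (φ P) ≡ P) →
      (isPartialPartition P ∧ p P) ≡ true → (isPartialPartition (φ P) ∧ q (φ P)) ≡ true × ψ (φ P) ≡ P
    lift p q φ ψ P h e with ∧-elim {isPartialPartition P} e
    ... | pp , pP with h (isPP-elim pp) pP
    ... | ppφ , qφ , ψφ = ∧-intro (isPP-intro ppφ) qφ , ψφ

  -- On these partitions `remove x` is a bijection: y survives and marks the part to which x has to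
  -- return.
  ∑-attached : {x y : Fin n} → y ≢ x → (f : PRel n → Carrier) →
    ∑PP (λ P → when (x ∼⟨ P ⟩ y) (f (remove x P))) ≈
    ∑PP (λ P → when (not (x ∼⟨ P ⟩ x) ∧ (y ∼⟨ P ⟩ y)) (f P))
  ∑-attached {n} {x} {y} y≢x = ∑PP-reindex _ _ (remove x) (λ P → add x (λ i → y ∼⟨ P ⟩ i) P) to from
    where
    to : ∀ P → IsPP P → x ∼[ P ] y → IsPP (remove x P) ×
      (not (x ∼⟨ remove x P ⟩ x) ∧ (y ∼⟨ remove x P ⟩ y)) ≡ true ×
      add x (λ i → y ∼⟨ remove x P ⟩ i) (remove x P) ≡ P
    to P pp x∼y = remove-isPP pp ,
      ∧-intro (not-intro (remove-uncovers {P = P})) (remove-intro {P = P} (∼-reflʳ x∼y) y≢x y≢x) ,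
      add-remove pp (∼-reflˡ x∼y) λ i i≢x → bool-ext
        (λ h → ∼-trans x∼y (proj₁ (remove-elim {P = P} h)))
        (λ h → remove-intro {P = P} (∼-trans (∼-sym x∼y) h) y≢x i≢x)
      where open IsPP pp
    from : ∀ P → IsPP P → (not (x ∼⟨ P ⟩ x) ∧ (y ∼⟨ P ⟩ y)) ≡ true →
      IsPP (add x (λ i → y ∼⟨ P ⟩ i) P) × x ∼[ add x (λ i → y ∼⟨ P ⟩ i) P ] y ×
      remove x (add x (λ i → y ∼⟨ P ⟩ i) P) ≡ P
    from P pp h with ∧-elim {not (x ∼⟨ P ⟩ x)} h
    ... | x≁x , y∼y = add-isPP pp (λ u v → ∼-trans (∼-sym u) v) ∼-trans ,
      ≡.trans (add-xj {P = P} y≢x) y∼y , remove-add pp (not-elim x≁x)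
      where open IsPP pp

  -- Again `remove x` is a bijection, since a point that was a part of its own can return in only
  -- one way.
  ∑-alone : (x : Fin n) (f : PRel n → Carrier) →
    ∑PP (λ P → when (isAlone x P) (f (remove x P))) ≈ ∑PP (λ P → when (not (x ∼⟨ P ⟩ x)) (f P))
  ∑-alone {n} x = ∑PP-reindex _ _ (remove x) (add x (λ _ → false)) to from
    where
    to : ∀ P → IsPP P → isAlone x P ≡ true →
      IsPP (remove x P) × not (x ∼⟨ remove x P ⟩ x) ≡ true × add x (λ _ → false) (remove x P) ≡ P
    to P pp alone with alone-elim {P = P} alone
    ... | x∼x , only = remove-isPP pp , not-intro (remove-uncovers {P = P}) ,
      add-remove pp x∼x λ i i≢x → ≡.sym (≢true⇒≡false λ x∼i → i≢x (only i x∼i))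
    from : ∀ P → IsPP P → not (x ∼⟨ P ⟩ x) ≡ true →
      IsPP (add x (λ _ → false) P) × isAlone x (add x (λ _ → false) P) ≡ true ×
      remove x (add x (λ _ → false) P) ≡ P
    from P pp x≁x = add-isPP pp (λ ()) (λ ()) ,
      alone-intro {P = add x (λ _ → false) P} (add-xx {P = P}) only , remove-add pp (not-elim x≁x)
      where
      only : ∀ j → x ∼[ add x (λ _ → false) P ] j → j ≡ x
      only j h with j Fin.≟ x
      ... | yes j≡x = j≡x
      ... | no j≢x with () ← ≡.trans (≡.sym (add-xj {P = P} j≢x)) h

  -- If x has a companion, its part without x is a part of `remove x P`, and only the minimum i of
  -- that part contributes to the sum. The index i thus names the part that x joined.
  alone-or-attached : {P : PRel n} → IsPP P → ∀ x g → when (x ∼⟨ P ⟩ x) g ≈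
    when (isAlone x P) g + ∑ (allFin n) (λ i → when (x ∼⟨ P ⟩ i) (when (isPartMin (remove x P) i) g))
  alone-or-attached {n} {P} pp x g with Fin.any? (λ y → (x ∼⟨ P ⟩ y) Bool.≟ true ×-dec ¬? (y Fin.≟ x))
  ... | yes (y , x∼y , y≢x) = begin
    when (x ∼⟨ P ⟩ x) g
      ≈⟨ trans (when-true (∼-reflˡ x∼y)) (sym (when-true (remove-intro {P = P} (∼-reflʳ x∼y) y≢x y≢x))) ⟩
    when (y ∼⟨ P′ ⟩ y) g
      ≈⟨ big-min (remove-isPP pp) y g ⟨
    ∑ F (λ i → when (isPartMin P′ i ∧ (i ∼⟨ P′ ⟩ y)) g)
      ≈⟨ big-cong F (λ i → trans (when-≡ (eq i)) (when-∧ (x ∼⟨ P ⟩ i) _)) ⟩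
    ∑ F (λ i → when (x ∼⟨ P ⟩ i) (when (isPartMin P′ i) g))
      ≈⟨ +-identityˡ _ ⟨
    0# + ∑ F (λ i → when (x ∼⟨ P ⟩ i) (when (isPartMin P′ i) g))
      ≈⟨ +-congʳ (when-false {isAlone x P} (λ h → y≢x (proj₂ (alone-elim {P = P} h) y x∼y))) ⟨
    when (isAlone x P) g + ∑ F (λ i → when (x ∼⟨ P ⟩ i) (when (isPartMin P′ i) g)) ∎
    where
    F = allFin n
    P′ = remove x P
    open IsPP pp
    eq : ∀ i → (isPartMin P′ i ∧ (i ∼⟨ P′ ⟩ y)) ≡ ((x ∼⟨ P ⟩ i) ∧ isPartMin P′ i)
    eq i = bool-ext
      (λ h → let m , i∼y = ∧-elim {isPartMin P′ i} h
             in ∧-intro (∼-trans x∼y (∼-sym (proj₁ (remove-elim {P = P} i∼y)))) m)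
      (λ h → let x∼i , m = ∧-elim h
             in ∧-intro m (remove-intro {P = P} (∼-trans (∼-sym x∼i) x∼y)
                  (proj₁ (proj₂ (remove-elim {P = P} (proj₁ (min-elim {P = P′} m))))) y≢x))
  ... | no none = begin
    when (x ∼⟨ P ⟩ x) g
      ≈⟨ when-≡ (bool-ext (λ x∼x → alone-intro {P = P} x∼x only) (proj₁ ∘ alone-elim {P = P})) ⟩
    when (isAlone x P) g
      ≈⟨ +-identityʳ _ ⟨
    when (isAlone x P) g + 0#
      ≈⟨ +-congˡ (trans (big-cong F (λ i → trans (when-cong (x ∼⟨ P ⟩ i) λ x∼i → when-false λ m →
           proj₁ (proj₂ (remove-elim {P = P} (proj₁ (min-elim {P = P′} m)))) (only i x∼i))
           (when-ε (x ∼⟨ P ⟩ i)))) (big-ε F)) ⟨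
    when (isAlone x P) g + ∑ F (λ i → when (x ∼⟨ P ⟩ i) (when (isPartMin P′ i) g)) ∎
    where
    F = allFin n
    P′ = remove x P
    only : ∀ j → x ∼[ P ] j → j ≡ x
    only j x∼j with j Fin.≟ x
    ... | yes j≡x = j≡x
    ... | no j≢x  = ⊥-elim (none (j , x∼j , j≢x))

  -- The condition q sees only `remove x P`, so the left side can be summed over the fibres of
  -- `remove x`. Over a partition with k parts the fibre has one member with x alone and one for
  -- each part that x can join, and `weight-fibre` evaluates it.
  ∑-remove : (x : Fin n) (q : PRel n → Bool) →
    ∑PP (λ P → when (x ∼⟨ P ⟩ x) (when (q (remove x P)) (weight P))) ≈
    ∑PP (λ P → when (not (x ∼⟨ P ⟩ x)) (when (q P) (weight P)))
  ∑-remove {n} x q = begin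
    ∑PP (λ P → when (x ∼⟨ P ⟩ x) (when (q (remove x P)) (weight P)))
      ≈⟨ ∑PP-cong (λ P pp → trans (alone-or-attached pp x _) (+-cong
           (when-cong (isAlone x P) λ h → when-cong (q (remove x P)) λ _ → weight-alone pp h)
           (big-cong F λ i → when-cong (x ∼⟨ P ⟩ i) λ x∼i → when-cong (isPartMin (remove x P) i) λ m →
             when-cong (q (remove x P)) λ _ → weight-attached pp x∼i
               (proj₁ (proj₂ (remove-elim {P = P} (proj₁ (min-elim {P = remove x P} m)))))))) ⟩
    ∑PP (λ P → when (isAlone x P) (alone (remove x P)) + ∑ F (λ i → when (x ∼⟨ P ⟩ i) (attached i (remove x P))))
      ≈⟨ trans (∑PP-+ {n}) (+-cong (∑-alone x alone) (∑PP-swap {n} F)) ⟩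
    ∑PP (λ P → when (not (x ∼⟨ P ⟩ x)) (alone P)) + ∑ F (λ i → ∑PP (λ P → when (x ∼⟨ P ⟩ i) (attached i (remove x P))))
      ≈⟨ +-congˡ (big-cong F attach) ⟩
    ∑PP (λ P → when (not (x ∼⟨ P ⟩ x)) (alone P)) + ∑ F (λ i → ∑PP (λ P → when (not (x ∼⟨ P ⟩ x) ∧ (i ∼⟨ P ⟩ i)) (attached i P)))
      ≈⟨ trans (∑PP-+ {n}) (+-congˡ (∑PP-swap {n} F)) ⟨
    ∑PP (λ P → when (not (x ∼⟨ P ⟩ x)) (alone P) + ∑ F (λ i → when (not (x ∼⟨ P ⟩ x) ∧ (i ∼⟨ P ⟩ i)) (attached i P)))
      ≈⟨ ∑PP-cong (λ P _ → fibre P) ⟩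
    ∑PP (λ P → when (not (x ∼⟨ P ⟩ x)) (when (q P) (weight P))) ∎
    where
    F = allFin n
    alone : PRel n → Carrier
    alone P = when (q P) (- coverSign P * signedFact (suc (numParts P)))
    attached : Fin n → PRel n → Carrier
    attached i P = when (isPartMin P i) (when (q P) (- weight P))
    attach : ∀ i → ∑PP (λ P → when (x ∼⟨ P ⟩ i) (attached i (remove x P)))
                 ≈ ∑PP (λ P → when (not (x ∼⟨ P ⟩ x) ∧ (i ∼⟨ P ⟩ i)) (attached i P))
    attach i with i Fin.≟ x
    ... | no i≢x     = ∑-attached i≢x (attached i)
    -- Both sides vanish: x is not a part minimum of `remove x P`, and it cannot be covered and
    -- uncovered at once.
    ... | yes ≡.refl = trans
      (∑PP-0 λ P _ → trans (when-cong (x ∼⟨ P ⟩ x) λ _ →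
         when-false λ m → remove-uncovers {P = P} (proj₁ (min-elim {P = remove x P} m))) (when-ε (x ∼⟨ P ⟩ x)))
      (sym (∑PP-0 λ P _ → when-false {not (x ∼⟨ P ⟩ x) ∧ (x ∼⟨ P ⟩ x)} λ h →
         let u , v = ∧-elim {not (x ∼⟨ P ⟩ x)} h in not-elim u v))
    fibre : ∀ P → when (not (x ∼⟨ P ⟩ x)) (alone P) +
                  ∑ F (λ i → when (not (x ∼⟨ P ⟩ x) ∧ (i ∼⟨ P ⟩ i)) (attached i P))
                ≈ when (not (x ∼⟨ P ⟩ x)) (when (q P) (weight P))
    fibre P = begin
      when u (alone P) + ∑ F (λ i → when (u ∧ (i ∼⟨ P ⟩ i)) (attached i P))
        ≈⟨ +-congˡ (big-cong F (λ i → trans (when-∧ u (i ∼⟨ P ⟩ i)) (when-cong u λ _ → covered i))) ⟩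
      when u (alone P) + ∑ F (λ i → when u (attached i P))
        ≈⟨ +-congˡ (big-when u F) ⟩
      when u (alone P) + when u (∑ F (λ i → attached i P))
        ≈⟨ when-∙ u ⟨
      when u (alone P + ∑ F (λ i → attached i P))
        ≈⟨ when-cong u (λ _ → +-congˡ (∑-when-const (isPartMin P) F)) ⟩
      when u (alone P + ⟦ length (filterᵇ (isPartMin P) F) ⟧ * when (q P) (- weight P))
        ≡⟨ ≡.cong (λ k → when u (alone P + ⟦ k ⟧ * when (q P) (- weight P)))
             (List.length-map (partOf P) (filterᵇ (isPartMin P) F)) ⟨
      when u (alone P + ⟦ numParts P ⟧ * when (q P) (- weight P))
        ≈⟨ when-cong u (λ _ → trans (+-congˡ (when-*ˡ (q P))) (sym (when-∙ (q P)))) ⟩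
      when u (when (q P) (- coverSign P * signedFact (suc (numParts P)) + ⟦ numParts P ⟧ * - weight P))
        ≈⟨ when-cong u (λ _ → when-cong (q P) (λ _ → weight-fibre (numParts P) (coverSign P))) ⟩
      when u (when (q P) (weight P)) ∎
      where
      u = not (x ∼⟨ P ⟩ x)
      covered : ∀ i → when (i ∼⟨ P ⟩ i) (attached i P) ≈ attached i P
      covered i = trans (sym (when-∧ (i ∼⟨ P ⟩ i) (isPartMin P i)))
        (when-≡ (bool-ext (proj₂ ∘ ∧-elim {i ∼⟨ P ⟩ i}) (λ m → ∧-intro (proj₁ (min-elim {P = P} m)) m)))

-- Transpositions and signs

transpose-l : (x y : Fin n) → transpose x y x ≡ y
transpose-l x y rewrite dec-true (x Fin.≟ x) ≡.refl = ≡.refl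

transpose-other : {x y k : Fin n} → k ≢ x → k ≢ y → transpose x y k ≡ k
transpose-other {x = x} {y} {k} k≢x k≢y
  rewrite dec-false (k Fin.≟ x) k≢x | dec-false (k Fin.≟ y) k≢y = ≡.refl

transpose-r : (x y : Fin n) → transpose x y y ≡ x
transpose-r x y with y Fin.≟ x
... | yes ≡.refl = ≡.refl
... | no y≢x rewrite dec-true (y Fin.≟ y) ≡.refl = ≡.refl

data TransposeView (x y k : Fin n) : Set where
  isˡ   : k ≡ x → TransposeView x y k
  isʳ   : k ≡ y → TransposeView x y k
  other : k ≢ x → k ≢ y → TransposeView x y k

transposeView : (x y k : Fin n) → TransposeView x y k
transposeView x y k with k Fin.≟ x | k Fin.≟ y
... | yes p | _     = isˡ p
... | no _  | yes q = isʳ q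
... | no p  | no q  = other p q

transpose-comm : (x y k : Fin n) → transpose x y k ≡ transpose y x k
transpose-comm x y k with transposeView x y k
... | isˡ ≡.refl  = ≡.trans (transpose-l x y) (≡.sym (transpose-r y x))
... | isʳ ≡.refl  = ≡.trans (transpose-r x y) (≡.sym (transpose-l y x))
... | other p q = ≡.trans (transpose-other p q) (≡.sym (transpose-other q p))

transpose-involutive : (x y : Fin n) {k : Fin n} → transpose x y (transpose x y k) ≡ k
transpose-involutive x y {k} = ≡.trans (≡.cong (transpose x y) (transpose-comm x y k)) (transpose-inverse x y)

transpose-injective : (x y : Fin n) → Injective _≡_ _≡_ (transpose x y)
transpose-injective x y {k} {m} eq = ≡.trans (≡.sym (transpose-involutive x y))
  (≡.trans (≡.cong (transpose x y) eq) (transpose-involutive x y))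

-- Conjugating (a c) by (c b) renames c to b. Taking c next to b makes the gap to a smaller, which
-- drives the induction in `sign-transpose<`.
transpose-conjugate : {a b c : Fin n} → a ≢ b → c ≢ a → c ≢ b → ∀ k →
  transpose c b (transpose a c (transpose c b k)) ≡ transpose a b k
transpose-conjugate {a = a} {b} {c} a≢b c≢a c≢b k with transposeView a b k
... | isˡ ≡.refl
  rewrite transpose-other {k = k} (c≢a ∘ ≡.sym) a≢b | transpose-l k c | transpose-l c b = ≡.sym (transpose-l k b)
... | isʳ ≡.refl
  rewrite transpose-r c k | transpose-r a c | transpose-other {k = a} (c≢a ∘ ≡.sym) a≢b = ≡.sym (transpose-r a k)
... | other k≢a k≢b with transposeView c b k
...   | isʳ k≡b = ⊥-elim (k≢b k≡b)
...   | isˡ ≡.refl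
  rewrite transpose-l k b | transpose-other {k = b} (a≢b ∘ ≡.sym) (c≢b ∘ ≡.sym) | transpose-r k b
    = ≡.sym (transpose-other k≢a k≢b)
...   | other k≢c _
  rewrite transpose-other {k = k} k≢c k≢b | transpose-other {k = k} k≢a k≢c
    = ≡.trans (transpose-other k≢c k≢b) (≡.sym (transpose-other k≢a k≢b))

-- Nothing lies strictly between a and b, so exchanging them alters the relative order of no pair
-- but (a , b).
adjacent-mono : {a b u v : Fin n} → toℕ b ≡ suc (toℕ a) → u < v → ¬ (u ≡ a × v ≡ b) →
  transpose a b u < transpose a b v
adjacent-mono {a = a} {b} {u} {v} adj u<v off with transposeView a b u | transposeView a b v
... | isˡ ≡.refl | isˡ ≡.refl = ⊥-elim (ℕ.<-irrefl ≡.refl u<v)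
... | isˡ ≡.refl | isʳ ≡.refl = ⊥-elim (off (≡.refl , ≡.refl))
... | isˡ ≡.refl | other p q
  rewrite transpose-l u b | transpose-other p q =
    ℕ.≤∧≢⇒< (≡.subst (ℕ._≤ toℕ v) (≡.sym adj) u<v) (q ∘ Fin.toℕ-injective ∘ ≡.sym)
... | isʳ ≡.refl | isˡ ≡.refl
  rewrite transpose-l v u | transpose-r v u = ⊥-elim (ℕ.<-asym u<v (≡.subst (suc (toℕ v) ℕ.≤_) (≡.sym adj) ℕ.≤-refl))
... | isʳ ≡.refl | isʳ ≡.refl = ⊥-elim (ℕ.<-irrefl ≡.refl u<v)
... | isʳ ≡.refl | other p q
  rewrite transpose-r a u | transpose-other p q =
    ℕ.<-trans (≡.subst (suc (toℕ a) ℕ.≤_) (≡.sym adj) ℕ.≤-refl) u<v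
... | other p q | isˡ ≡.refl
  rewrite transpose-l v b | transpose-other p q = ≡.subst (suc (toℕ u) ℕ.≤_) (≡.sym adj) (ℕ.m<n⇒m<1+n u<v)
... | other p q | isʳ ≡.refl
  rewrite transpose-r a v | transpose-other p q =
    ℕ.≤∧≢⇒< (ℕ.s≤s⁻¹ (≡.subst (suc (toℕ u) ℕ.≤_) adj u<v)) (p ∘ Fin.toℕ-injective)
... | other p q | other p′ q′
  rewrite transpose-other p q | transpose-other p′ q′ = u<v

<⇒gap : {x y : Fin n} → x < y → toℕ y ≡ suc ((toℕ y ℕ.∸ suc (toℕ x)) ℕ.+ toℕ x)
<⇒gap {x = x} x<y = ≡.sym (≡.trans (≡.sym (ℕ.+-suc _ (toℕ x))) (ℕ.m∸n+n≡m x<y))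

module Sign {c ℓ} (R : CommutativeRing c ℓ) where
  open CommutativeRing R hiding (zero)
  open RingOps R
  private module Π = BigOp *-commutativeMonoid
  open import Algebra.Properties.Ring ring using (-1*x≈-x; -‿involutive)
  open import Relation.Binary.Reasoning.Setoid setoid

  isInversion : (Fin n → Fin n) → Fin n → Fin n → Bool
  isInversion σ i j = (i <ᵇ j) ∧ (σ j <ᵇ σ i)

  -- This is -1 to the number of inversions, taken for functions so that transpositions act by plain
  -- composition, and written as a double product so that two signs compare pair by pair.
  sign : (Fin n → Fin n) → Carrier
  sign {n} σ = ∏ (allFin n) (λ i → ∏ (allFin n) (λ j → Π.when (isInversion σ i j) (- 1#)))

  sign-cong : {σ τ : Fin n → Fin n} → (∀ i → σ i ≡ τ i) → sign σ ≈ sign τ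
  sign-cong {n} eq = Π.big-cong (allFin n) λ i → Π.big-cong (allFin n) λ j →
    Π.when-≡ (≡.cong₂ (λ u v → (i <ᵇ j) ∧ (u <ᵇ v)) (eq j) (eq i))

  neg1^-inversions : (σ : Vec (Fin n) n) → neg1^ (inversions σ) ≈ sign (Vec.lookup σ)
  neg1^-inversions {n} σ = begin
    neg1^ (length (List.concatMap inv F))
      ≈⟨ neg1^-length (List.concatMap inv F) ⟩
    ∏ (List.concatMap inv F) (λ _ → - 1#)
      ≈⟨ Π.big-concatMap inv F ⟩
    ∏ F (λ i → ∏ (inv i) (λ _ → - 1#))
      ≈⟨ Π.big-cong F (λ i → Π.big-filter (isInversion (Vec.lookup σ) i) F) ⟩
    sign (Vec.lookup σ) ∎
    where
    F = allFin n
    inv = λ i → filterᵇ (isInversion (Vec.lookup σ) i) F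
    neg1^-length : ∀ {a} {X : Set a} (xs : List X) → neg1^ (length xs) ≈ ∏ xs (λ _ → - 1#)
    neg1^-length []       = refl
    neg1^-length (x ∷ xs) = *-congˡ (neg1^-length xs)

  sign-id : {σ : Fin n → Fin n} → (∀ i → σ i ≡ i) → sign σ ≈ 1#
  sign-id {n} {σ} fix = trans
    (Π.big-cong F λ i → trans (Π.big-cong F λ j → Π.when-false {isInversion σ i j} (ordered i j)) (Π.big-ε F))
    (Π.big-ε F)
    where
    F = allFin n
    ordered : ∀ i j → ¬ (isInversion σ i j ≡ true)
    ordered i j h with ∧-elim {i <ᵇ j} h
    ... | i<j , σj<σi = ℕ.<-asym (⌊⌋-elim (i <? j) i<j)
      (≡.subst₂ _<_ (fix j) (fix i) (⌊⌋-elim (σ j <? σ i) σj<σi))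

  module _ {a b : Fin n} (adj : toℕ b ≡ suc (toℕ a)) where
    private
      τ = transpose a b
      F = allFin n

      a<b : a < b
      a<b = ℕ.≤-reflexive (≡.sym adj)

    -- The positions p < q hold a and b in increasing order. Exchanging these adjacent values makes
    -- (p , q) an inversion and leaves the status of every other pair as it was.
    sign-create : {σ : Fin n → Fin n} → Injective _≡_ _≡_ σ →
      ∀ {p q} → σ p ≡ a → σ q ≡ b → p < q → sign (τ ∘ σ) ≈ - sign σ
    sign-create {σ} inj {p} {q} σp σq p<q = begin
      ∏ F (λ i → ∏ F (λ j → Π.when (isInversion (τ ∘ σ) i j) (- 1#)))
        ≈⟨ Π.big-cong F (λ i → Π.big-cong F λ j → trans (Π.when-≡ (eq i j)) (Π.when-∨ (created i j) _ (disjoint i j))) ⟩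
      ∏ F (λ i → ∏ F (λ j → Π.when (created i j) (- 1#) * Π.when (isInversion σ i j) (- 1#)))
        ≈⟨ trans (Π.big-cong F λ i → Π.big-∙ F) (Π.big-∙ F) ⟩
      ∏ F (λ i → ∏ F (λ j → Π.when (created i j) (- 1#))) * sign σ
        ≈⟨ *-congʳ (Π.big-cong F λ i → trans (Π.big-cong F λ j → Π.when-∧ (i == p) (j == q)) (Π.big-when (i == p) F)) ⟩
      ∏ F (λ i → Π.when (i == p) (∏ F (λ j → Π.when (j == q) (- 1#)))) * sign σ
        ≈⟨ *-congʳ (trans (Π.enum-allFin p _) (Π.enum-allFin q _)) ⟩
      - 1# * sign σ
        ≈⟨ -1*x≈-x _ ⟩
      - sign σ ∎
      where
      created : Fin n → Fin n → Bool
      created i j = (i == p) ∧ (j == q)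
      disjoint : ∀ i j → created i j ≡ true → isInversion σ i j ≡ true → ⊥
      disjoint i j h inv with ∧-elim {i == p} h | ∧-elim {i <ᵇ j} inv
      ... | i≡p , j≡q | _ , σj<σi with ==-elim {i = i} i≡p | ==-elim {i = j} j≡q
      ... | ≡.refl | ≡.refl = ℕ.<-asym a<b (≡.subst₂ _<_ σq σp (⌊⌋-elim (σ j <? σ i) σj<σi))
      eq : ∀ i j → isInversion (τ ∘ σ) i j ≡ (created i j ∨ isInversion σ i j)
      eq i j = bool-ext to from
        where
        to : isInversion (τ ∘ σ) i j ≡ true → (created i j ∨ isInversion σ i j) ≡ true
        to inv with created i j in e
        ... | true = ≡.refl
        ... | false with ∧-elim {i <ᵇ j} inv
        -- Applying τ once more recovers the order of the values of σ. The pair that `adjacent-mono`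
        -- excludes would force i = p and j = q, against e.
        ... | i<j , lt = ∧-intro i<j (⌊⌋-intro (σ j <? σ i) (≡.subst₂ _<_
                (transpose-involutive a b) (transpose-involutive a b)
                (adjacent-mono adj (⌊⌋-elim (τ (σ j) <? τ (σ i)) lt) λ (u , v) → true≢false (∧-intro
                  (==-intro (inj (≡.trans (≡.sym (transpose-involutive a b)) (≡.trans (≡.cong τ v) (≡.trans (transpose-r a b) (≡.sym σp))))))
                  (==-intro (inj (≡.trans (≡.sym (transpose-involutive a b)) (≡.trans (≡.cong τ u) (≡.trans (transpose-l a b) (≡.sym σq))))))) e)))
        from : (created i j ∨ isInversion σ i j) ≡ true → isInversion (τ ∘ σ) i j ≡ true
        from h with ∨-elim {created i j} h
        ... | inj₁ h′ with ∧-elim {i == p} h′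
        ... | i≡p , j≡q with ==-elim {i = i} i≡p | ==-elim {i = j} j≡q
        ... | ≡.refl | ≡.refl = ∧-intro (⌊⌋-intro (i <? j) p<q) (⌊⌋-intro (τ (σ j) <? τ (σ i))
                (≡.subst₂ _<_ (≡.sym (≡.trans (≡.cong τ σq) (transpose-r a b)))
                              (≡.sym (≡.trans (≡.cong τ σp) (transpose-l a b))) a<b))
        from h | inj₂ inv with ∧-elim {i <ᵇ j} inv
        ... | i<j , lt = ∧-intro i<j (⌊⌋-intro (τ (σ j) <? τ (σ i))
                (adjacent-mono adj (⌊⌋-elim (σ j <? σ i) lt) λ (u , v) → ℕ.<-asym (⌊⌋-elim (i <? j) i<j)
                  (≡.subst₂ _<_ (inj (≡.trans σp (≡.sym u))) (inj (≡.trans σq (≡.sym v))) p<q)))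

    sign-adjacent : {σ : Fin n → Fin n} → Injective _≡_ _≡_ σ → sign (τ ∘ σ) ≈ - sign σ
    sign-adjacent {σ} inj with injective⇒surjective inj a | injective⇒surjective inj b
    ... | p , σp | q , σq with Fin.<-cmp p q
    ... | tri< p<q _ _    = sign-create inj σp σq p<q
    ... | tri≈ _ ≡.refl _ = ⊥-elim (ℕ.<-irrefl (≡.cong toℕ (≡.trans (≡.sym σp) σq)) a<b)
    -- Here (q , p) is an inversion of σ that τ destroys. So `sign-create` is applied to τ ∘ σ, and
    -- τ is its own inverse.
    ... | tri> _ _ q<p    = begin
      sign (τ ∘ σ)          ≈⟨ -‿involutive _ ⟨
      - - sign (τ ∘ σ)      ≈⟨ -‿cong (sign-create {τ ∘ σ} (inj ∘ transpose-injective a b)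
                                 (≡.trans (≡.cong τ σq) (transpose-r a b))
                                 (≡.trans (≡.cong τ σp) (transpose-l a b)) q<p) ⟨
      - sign (τ ∘ τ ∘ σ)    ≈⟨ -‿cong (sign-cong λ i → transpose-involutive a b) ⟩
      - sign σ              ∎

  -- Here d is one less than the distance from a to b, so d = 0 is adjacency. With m just below b,
  -- (a b) = (m b)(a m)(m b): two adjacent transpositions around one of smaller gap, and three sign
  -- changes amount to one.
  sign-transpose< : ∀ d {a b : Fin n} → toℕ b ≡ suc (d ℕ.+ toℕ a) →
    {σ : Fin n → Fin n} → Injective _≡_ _≡_ σ → sign (transpose a b ∘ σ) ≈ - sign σ
  sign-transpose< zero    eq inj = sign-adjacent eq inj
  sign-transpose< {suc n} (suc d) {a} {suc b′} eq {σ} inj = begin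
    sign (transpose a b ∘ σ)
      ≈⟨ sign-cong (λ i → transpose-conjugate a≢b m≢a m≢b (σ i)) ⟨
    sign (transpose m b ∘ transpose a m ∘ transpose m b ∘ σ)
      ≈⟨ sign-adjacent adj (inj ∘ transpose-injective m b ∘ transpose-injective a m) ⟩
    - sign (transpose a m ∘ transpose m b ∘ σ)
      ≈⟨ -‿cong (sign-transpose< d ac (inj ∘ transpose-injective m b)) ⟩
    - - sign (transpose m b ∘ σ)
      ≈⟨ -‿involutive _ ⟩
    sign (transpose m b ∘ σ)
      ≈⟨ sign-adjacent adj inj ⟩
    - sign σ ∎
    where
    b = suc b′
    m = inject₁ b′
    adj : toℕ b ≡ suc (toℕ m)
    adj = ≡.cong suc (≡.sym (Fin.toℕ-inject₁ b′))
    ac : toℕ m ≡ suc (d ℕ.+ toℕ a)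
    ac = ≡.trans (Fin.toℕ-inject₁ b′) (ℕ.suc-injective eq)
    m≢b : m ≢ b
    m≢b e = ℕ.1+n≢n (≡.trans (≡.sym adj) (≡.cong toℕ (≡.sym e)))
    above : ∀ {k l} → k ≡ suc (l ℕ.+ toℕ a) → k ≢ toℕ a
    above {l = l} e e′ = ℕ.<-irrefl (≡.trans (≡.sym e′) e) (ℕ.s≤s (ℕ.m≤n+m (toℕ a) l))
    m≢a : m ≢ a
    m≢a e = above ac (≡.cong toℕ e)
    a≢b : a ≢ b
    a≢b e = above eq (≡.cong toℕ (≡.sym e))

  sign-transpose : {x y : Fin n} → x ≢ y →
    {σ : Fin n → Fin n} → Injective _≡_ _≡_ σ → sign (transpose x y ∘ σ) ≈ - sign σ
  sign-transpose {n} {x} {y} x≢y {σ} inj with Fin.<-cmp x y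
  ... | tri≈ _ x≡y _ = ⊥-elim (x≢y x≡y)
  ... | tri< x<y _ _ = sign-transpose< _ (<⇒gap x<y) inj
  ... | tri> _ _ y<x = trans (sign-cong λ i → transpose-comm x y (σ i)) (sign-transpose< _ (<⇒gap y<x) inj)

-- The coefficients of the expansion

-- isChosen P i j: the entry a_{i,j} occurs in the i-th factor of the term of P.
isChosen : PRel n → Fin n → Fin n → Bool
isChosen P i j = if i ∼⟨ P ⟩ i then (j ∼⟨ P ⟩ i) ∧ not (j == i) else ((j == i) ∨ (j ∼⟨ P ⟩ j))

Chosen : PRel n → Fin n → Fin n → Set
Chosen P i j = (i ∼[ P ] i × j ∼[ P ] i × j ≢ i) ⊎ (¬ (i ∼[ P ] i) × (j ≡ i ⊎ j ∼[ P ] j))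

chosen-intro : ∀ (P : PRel n) i j → Chosen P i j → isChosen P i j ≡ true
chosen-intro P i j (inj₁ (i∼i , j∼i , j≢i)) =
  ≡.trans (if-true i∼i) (∧-intro j∼i (not-intro (j≢i ∘ ==-elim)))
chosen-intro P i j (inj₂ (i≁i , inj₁ j≡i)) =
  ≡.trans (if-false (≢true⇒≡false i≁i)) (≡.cong (_∨ (j ∼⟨ P ⟩ j)) (==-intro j≡i))
chosen-intro P i j (inj₂ (i≁i , inj₂ j∼j)) =
  ≡.trans (if-false (≢true⇒≡false i≁i)) (∨-introʳ {β = j == i} j∼j)

chosen-elim : ∀ (P : PRel n) i j → isChosen P i j ≡ true → Chosen P i j
chosen-elim P i j h with i ∼⟨ P ⟩ i in e
... | true  = let j∼i , j≢i = ∧-elim h in inj₁ (≡.refl , j∼i , not-elim j≢i ∘ ==-intro)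
... | false with ∨-elim {j == i} h
...   | inj₁ j≡i = inj₂ ((λ ()) , inj₁ (==-elim j≡i))
...   | inj₂ j∼j = inj₂ ((λ ()) , inj₂ j∼j)

isCompatible : (Fin n → Fin n) → PRel n → Bool
isCompatible {n} f P = allᵇ (λ i → isChosen P i (f i)) (allFin n)

compatible-intro : (f : Fin n → Fin n) (P : PRel n) → (∀ i → Chosen P i (f i)) → isCompatible f P ≡ true
compatible-intro f P h = allᵇ-intro λ i → chosen-intro P i (f i) (h i)

compatible-elim : (f : Fin n → Fin n) (P : PRel n) → isCompatible f P ≡ true → ∀ i → Chosen P i (f i)
compatible-elim f P h i = chosen-elim P i (f i) (allᵇ-elim h i)

module _ {f : Fin n → Fin n} {x : Fin n} (miss : ∀ i → f i ≢ x) {P : PRel n} (pp : IsPP P) where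
  open IsPP pp
  private
    P′ = remove x P

    -- Since f misses x, the condition at a point other than x never refers to x, so it is
    -- insensitive to the removal.
    chosen-remove : ∀ {i} → i ≢ x → Chosen P i (f i) → Chosen P′ i (f i)
    chosen-remove i≢x (inj₁ (i∼i , fi∼i , fi≢i)) =
      inj₁ (remove-intro {P = P} i∼i i≢x i≢x , remove-intro {P = P} fi∼i (miss _) i≢x , fi≢i)
    chosen-remove i≢x (inj₂ (i≁i , inj₁ fi≡i)) = inj₂ (i≁i ∘ proj₁ ∘ remove-elim {P = P} , inj₁ fi≡i)
    chosen-remove i≢x (inj₂ (i≁i , inj₂ fi∼fi)) =
      inj₂ (i≁i ∘ proj₁ ∘ remove-elim {P = P} , inj₂ (remove-intro {P = P} fi∼fi (miss _) (miss _)))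

    chosen-unremove : ∀ {i} → i ≢ x → Chosen P′ i (f i) → Chosen P i (f i)
    chosen-unremove i≢x (inj₁ (i∼i , fi∼i , fi≢i)) =
      inj₁ (proj₁ (remove-elim {P = P} i∼i) , proj₁ (remove-elim {P = P} fi∼i) , fi≢i)
    chosen-unremove i≢x (inj₂ (i≁i , inj₁ fi≡i)) = inj₂ ((λ h → i≁i (remove-intro {P = P} h i≢x i≢x)) , inj₁ fi≡i)
    chosen-unremove i≢x (inj₂ (i≁i , inj₂ fi∼fi)) =
      inj₂ ((λ h → i≁i (remove-intro {P = P} h i≢x i≢x)) , inj₂ (proj₁ (remove-elim {P = P} fi∼fi)))

  -- A covered x has to be related to f x. After its removal x is an uncovered point sent to the
  -- still covered f x, which is allowed too, so compatibility passes both ways.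
  compatible-covered : ((x ∼⟨ P ⟩ x) ∧ isCompatible f P) ≡ ((x ∼⟨ P ⟩ f x) ∧ isCompatible f P′)
  compatible-covered = bool-ext to from
    where
    to : ((x ∼⟨ P ⟩ x) ∧ isCompatible f P) ≡ true → ((x ∼⟨ P ⟩ f x) ∧ isCompatible f P′) ≡ true
    to h with ∧-elim h
    ... | x∼x , comp with compatible-elim f P comp x
    ... | inj₂ (x≁x , _) = ⊥-elim (x≁x x∼x)
    ... | inj₁ (_ , fx∼x , _) = ∧-intro (∼-sym fx∼x) (compatible-intro f P′ chosen)
      where
      chosen : ∀ i → Chosen P′ i (f i)
      chosen i with i Fin.≟ x
      ... | yes ≡.refl = inj₂ (remove-uncovers {P = P} , inj₂ (remove-intro {P = P} (∼-reflˡ fx∼x) (miss _) (miss _)))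
      ... | no i≢x     = chosen-remove i≢x (compatible-elim f P comp i)
    from : ((x ∼⟨ P ⟩ f x) ∧ isCompatible f P′) ≡ true → ((x ∼⟨ P ⟩ x) ∧ isCompatible f P) ≡ true
    from h with ∧-elim h
    ... | x∼fx , comp = ∧-intro (∼-reflˡ x∼fx) (compatible-intro f P chosen)
      where
      chosen : ∀ i → Chosen P i (f i)
      chosen i with i Fin.≟ x
      ... | yes ≡.refl = inj₁ (∼-reflˡ x∼fx , ∼-sym x∼fx , miss x)
      ... | no i≢x     = chosen-unremove i≢x (compatible-elim f P′ comp i)

  -- As f x ≠ x, an uncovered x must be sent to a covered point. This gives the index set that
  -- `∑-attached` produces for y = f x, where the covered and uncovered cases meet.
  compatible-uncovered : (not (x ∼⟨ P ⟩ x) ∧ isCompatible f P) ≡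
                         ((not (x ∼⟨ P ⟩ x) ∧ (f x ∼⟨ P ⟩ f x)) ∧ isCompatible f P)
  compatible-uncovered = bool-ext to from
    where
    to : (not (x ∼⟨ P ⟩ x) ∧ isCompatible f P) ≡ true →
         ((not (x ∼⟨ P ⟩ x) ∧ (f x ∼⟨ P ⟩ f x)) ∧ isCompatible f P) ≡ true
    to h with ∧-elim {not (x ∼⟨ P ⟩ x)} h
    ... | x≁x , comp with compatible-elim f P comp x
    ... | inj₁ (x∼x , _)         = ⊥-elim (not-elim x≁x x∼x)
    ... | inj₂ (_ , inj₁ fx≡x)   = ⊥-elim (miss x fx≡x)
    ... | inj₂ (_ , inj₂ fx∼fx)  = ∧-intro (∧-intro x≁x fx∼fx) comp
    from : ((not (x ∼⟨ P ⟩ x) ∧ (f x ∼⟨ P ⟩ f x)) ∧ isCompatible f P) ≡ true →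
           (not (x ∼⟨ P ⟩ x) ∧ isCompatible f P) ≡ true
    from h with ∧-elim {not (x ∼⟨ P ⟩ x) ∧ (f x ∼⟨ P ⟩ f x)} h
    ... | u , comp = ∧-intro (proj₁ (∧-elim {not (x ∼⟨ P ⟩ x)} u)) comp

-- For a partial partition P, σ i ∼ i forces i to be covered, so P covers exactly X.
isAdmissible : (Fin n → Fin n) → (Fin n → Bool) → PRel n → Bool
isAdmissible {n} σ X P = allᵇ (λ i → ((i ∼⟨ P ⟩ i) ⇒ᵇ X i) ∧ (X i ⇒ᵇ (σ i ∼⟨ P ⟩ i))) (allFin n)

admissible-intro : {σ : Fin n → Fin n} {X : Fin n → Bool} (P : PRel n) →
  (∀ i → i ∼[ P ] i → X i ≡ true) → (∀ i → X i ≡ true → σ i ∼[ P ] i) → isAdmissible σ X P ≡ true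
admissible-intro P h k = allᵇ-intro λ i → ∧-intro (⇒ᵇ-intro (h i)) (⇒ᵇ-intro (k i))

admissible-elim : {σ : Fin n → Fin n} {X : Fin n → Bool} (P : PRel n) → isAdmissible σ X P ≡ true →
  (∀ i → i ∼[ P ] i → X i ≡ true) × (∀ i → X i ≡ true → σ i ∼[ P ] i)
admissible-elim {X = X} P h =
  (λ i → ⇒ᵇ-elim (proj₁ (∧-elim (allᵇ-elim h i)))) ,
  (λ i → ⇒ᵇ-elim (proj₂ (∧-elim {(i ∼⟨ P ⟩ i) ⇒ᵇ X i} (allᵇ-elim h i))))

moved : (Fin n → Fin n) → Fin n → Bool
moved σ i = not (σ i == i)

-- What separates the two conditions is an uncovered point sent to a covered one. The covered points
-- are mapped by σ injectively into themselves, hence onto themselves, so such a point would be a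
-- second preimage.
compatible-admissible : {σ : Fin n → Fin n} → Injective _≡_ _≡_ σ → {P : PRel n} → IsPP P →
  isCompatible σ P ≡ isAdmissible σ (moved σ) P
compatible-admissible {n} {σ} inj {P} pp = bool-ext to from
  where
  open IsPP pp
  to : isCompatible σ P ≡ true → isAdmissible σ (moved σ) P ≡ true
  to comp = admissible-intro P covered⇒moved moved⇒related
    where
    chosen = compatible-elim σ P comp
    step : ∀ {i} → i ∼[ P ] i → σ i ∼[ P ] i × σ i ≢ i
    step {i} i∼i with chosen i
    ... | inj₁ (_ , h)   = h
    ... | inj₂ (i≁i , _) = ⊥-elim (i≁i i∼i)
    covered⇒moved : ∀ i → i ∼[ P ] i → moved σ i ≡ true
    covered⇒moved i i∼i = not-intro (proj₂ (step i∼i) ∘ ==-elim)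
    -- Extending σ by the identity off the covered points gives a self-map of all of `Fin n`, so
    -- that `injective⇒surjective` applies without a count of the covered points.
    ρ : Fin n → Fin n
    ρ i = if i ∼⟨ P ⟩ i then σ i else i
    ρ-injective : Injective _≡_ _≡_ ρ
    ρ-injective {i} {j} eq with i ∼⟨ P ⟩ i in ei | j ∼⟨ P ⟩ j in ej
    ... | true  | true  = inj eq
    ... | false | false = eq
    ... | true  | false = ⊥-elim (true≢false (≡.subst (λ k → k ∼[ P ] k) eq (∼-reflˡ (proj₁ (step ei)))) ej)
    ... | false | true  = ⊥-elim (true≢false (≡.subst (λ k → k ∼[ P ] k) (≡.sym eq) (∼-reflˡ (proj₁ (step ej)))) ei)
    -- The covered points are closed under σ, hence permuted by it.
    image-covered⇒covered : ∀ i → σ i ∼[ P ] σ i → i ∼[ P ] i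
    image-covered⇒covered i h with injective⇒surjective ρ-injective (σ i)
    ... | j , eq with j ∼⟨ P ⟩ j in ej
    ...   | true  = ≡.subst (λ k → k ∼[ P ] k) (inj eq) ej
    ...   | false = ⊥-elim (true≢false (≡.subst (λ k → k ∼[ P ] k) (≡.sym eq) h) ej)
    moved⇒related : ∀ i → moved σ i ≡ true → σ i ∼[ P ] i
    moved⇒related i mv with chosen i
    ... | inj₁ (_ , h , _)         = h
    ... | inj₂ (_ , inj₁ σi≡i)     = ⊥-elim (not-elim mv (==-intro σi≡i))
    ... | inj₂ (i≁i , inj₂ σi∼σi)  = ⊥-elim (i≁i (image-covered⇒covered i σi∼σi))
  from : isAdmissible σ (moved σ) P ≡ true → isCompatible σ P ≡ true
  from adm = compatible-intro σ P chosen
    where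
    cov = proj₁ (admissible-elim P adm)
    rel = proj₂ (admissible-elim P adm)
    chosen : ∀ i → Chosen P i (σ i)
    chosen i with (i ∼⟨ P ⟩ i) in e | σ i Fin.≟ i
    ... | true  | _        = inj₁ (≡.refl , rel i (cov i e) , not-elim (cov i e) ∘ ==-intro)
    ... | false | yes σi≡i = inj₂ ((λ ()) , inj₁ σi≡i)
    ... | false | no σi≢i  = ⊥-elim (true≢false (∼-reflʳ (rel i (not-intro (σi≢i ∘ ==-elim)))) e)

_∖_ : (Fin n → Bool) → Fin n → (Fin n → Bool)
(X ∖ x) i = X i ∧ not (i == x)

∖-intro : {X : Fin n → Bool} {x i : Fin n} → X i ≡ true → i ≢ x → (X ∖ x) i ≡ true
∖-intro h i≢x = ∧-intro h (not-intro (i≢x ∘ ==-elim))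

∖-elim : (X : Fin n → Bool) {x i : Fin n} → (X ∖ x) i ≡ true → X i ≡ true × i ≢ x
∖-elim X {x} {i} h = let u , v = ∧-elim {X i} h in u , not-elim v ∘ ==-intro

module _ {σ : Fin n → Fin n} (inj : Injective _≡_ _≡_ σ) {X : Fin n → Bool} {x : Fin n} (Xx : X x ≡ true)
         {P : PRel n} (pp : IsPP P) where
  open IsPP pp
  private
    P′ = remove x P

  -- By injectivity only x is sent to x, so removing x destroys no required relation. All that
  -- `remove x P` forgets is the part in which x was, and `∑-remove` sums over that choice.
  admissible-fixed : σ x ≡ x → isAdmissible σ X P ≡ ((x ∼⟨ P ⟩ x) ∧ isAdmissible σ (X ∖ x) P′)
  admissible-fixed σx = bool-ext
    (λ adm → let cov , rel = admissible-elim P adm in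
      ∧-intro (∼-reflʳ (rel x Xx)) (admissible-intro P′
        (λ i h → let i∼i , i≢x , _ = remove-elim {P = P} h in ∖-intro {X = X} (cov i i∼i) i≢x)
        (λ i h → let Xi , i≢x = ∖-elim X h in
          remove-intro {P = P} (rel i Xi) (λ σi≡x → i≢x (inj (≡.trans σi≡x (≡.sym σx)))) i≢x)))
    (λ h → let x∼x , adm = ∧-elim h; cov , rel = admissible-elim P′ adm in
      admissible-intro P (covers cov)
        (λ i Xi → case-x i
          (λ { ≡.refl → ≡.subst (λ k → k ∼[ P ] x) (≡.sym σx) x∼x })
          (λ i≢x → proj₁ (remove-elim {P = P} (rel i (∖-intro {X = X} Xi i≢x))))))
    where
    case-x : ∀ {a} {A : Set a} i → (i ≡ x → A) → (i ≢ x → A) → A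
    case-x i u v with i Fin.≟ x
    ... | yes e = u e
    ... | no e  = v e
    covers : (∀ i → i ∼[ P′ ] i → (X ∖ x) i ≡ true) → ∀ i → i ∼[ P ] i → X i ≡ true
    covers cov i i∼i = case-x i (λ { ≡.refl → Xx })
      (λ i≢x → proj₁ (∖-elim X (cov i (remove-intro {P = P} i∼i i≢x i≢x))))

  -- Composing with the transposition bypasses x in its cycle: the preimage of x is sent straight to
  -- σ x, and x becomes fixed. As x ∼ σ x, being related to x and being related to σ x are the same.
  admissible-contract : X (σ x) ≡ true → σ x ≢ x →
    isAdmissible σ X P ≡ ((x ∼⟨ P ⟩ σ x) ∧ isAdmissible (transpose x (σ x) ∘ σ) (X ∖ x) P′)
  admissible-contract Xσx σx≢x = bool-ext to from
    where
    τ = transpose x (σ x)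
    to : isAdmissible σ X P ≡ true → ((x ∼⟨ P ⟩ σ x) ∧ isAdmissible (τ ∘ σ) (X ∖ x) P′) ≡ true
    to adm = ∧-intro (∼-sym (rel x Xx)) (admissible-intro P′ covered related)
      where
      cov = proj₁ (admissible-elim P adm)
      rel = proj₂ (admissible-elim P adm)
      covered : ∀ i → i ∼[ P′ ] i → (X ∖ x) i ≡ true
      covered i h = let i∼i , i≢x , _ = remove-elim {P = P} h in ∖-intro {X = X} (cov i i∼i) i≢x
      related : ∀ i → (X ∖ x) i ≡ true → τ (σ i) ∼[ P′ ] i
      related i h with ∖-elim X {x} {i} h | transposeView x (σ x) (σ i)
      ... | Xi , i≢x | isˡ σi≡x = ≡.subst (λ k → k ∼[ P′ ] i)
              (≡.sym (≡.trans (≡.cong τ σi≡x) (transpose-l x (σ x))))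
              (remove-intro {P = P} (∼-trans (rel x Xx) (≡.subst (λ k → k ∼[ P ] i) σi≡x (rel i Xi))) σx≢x i≢x)
      ... | Xi , i≢x | isʳ σi≡σx = ⊥-elim (i≢x (inj σi≡σx))
      ... | Xi , i≢x | other p q = ≡.subst (λ k → k ∼[ P′ ] i) (≡.sym (transpose-other p q))
              (remove-intro {P = P} (rel i Xi) p i≢x)
    from : ((x ∼⟨ P ⟩ σ x) ∧ isAdmissible (τ ∘ σ) (X ∖ x) P′) ≡ true → isAdmissible σ X P ≡ true
    from h = admissible-intro P covered related
      where
      x∼σx = proj₁ (∧-elim {x ∼⟨ P ⟩ σ x} h)
      adm = admissible-elim P′ (proj₂ (∧-elim {x ∼⟨ P ⟩ σ x} h))
      cov = proj₁ adm
      rel = proj₂ adm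
      covered : ∀ i → i ∼[ P ] i → X i ≡ true
      covered i i∼i with i Fin.≟ x
      ... | yes ≡.refl = Xx
      ... | no i≢x     = proj₁ (∖-elim X (cov i (remove-intro {P = P} i∼i i≢x i≢x)))
      related : ∀ i → X i ≡ true → σ i ∼[ P ] i
      related i Xi with i Fin.≟ x
      ... | yes ≡.refl = ∼-sym x∼σx
      ... | no i≢x with transposeView x (σ x) (σ i) | proj₁ (remove-elim {P = P} (rel i (∖-intro {X = X} Xi i≢x)))
      ...   | isˡ σi≡x  | r = ≡.subst (λ k → k ∼[ P ] i) (≡.sym σi≡x) (∼-trans x∼σx
                (≡.subst (λ k → k ∼[ P ] i) (≡.trans (≡.cong τ σi≡x) (transpose-l x (σ x))) r))
      ...   | isʳ σi≡σx | _ = ⊥-elim (i≢x (inj σi≡σx))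
      ...   | other p q | r = ≡.subst (λ k → k ∼[ P ] i) (transpose-other p q) r

admissible-∖-uncovers : {σ : Fin n → Fin n} {X : Fin n → Bool} {x : Fin n} {P : PRel n} →
  isAdmissible σ (X ∖ x) P ≡ true → not (x ∼⟨ P ⟩ x) ≡ true
admissible-∖-uncovers {X = X} {x} {P} adm = not-intro λ x∼x →
  proj₂ (∖-elim X (proj₁ (admissible-elim P adm) x x∼x)) ≡.refl

emptyRel : ∀ n → PRel n
emptyRel n = fromRel (λ _ _ → false)

-- Coefficients of non-surjective maps and of permutations

module Coefficients {c ℓ} (R : CommutativeRing c ℓ) where
  open CommutativeRing R hiding (zero)
  open RingOps R
  open Weights R
  open Sign R
  open import Algebra.Properties.Ring ring using (-‿involutive)
  open import Relation.Binary.Reasoning.Setoid setoid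

  coefficient : (Fin n → Fin n) → Carrier
  coefficient f = ∑PP (λ P → when (isCompatible f P) (weight P))

  coefficient-nonsurjective : {f : Fin n → Fin n} {x : Fin n} → (∀ i → f i ≢ x) → coefficient f ≈ 0#
  coefficient-nonsurjective {n} {f} {x} miss = begin
    ∑PP (λ P → when (isCompatible f P) (weight P))
      ≈⟨ trans (∑PP-cong λ P _ → sym (when-split (x ∼⟨ P ⟩ x))) (∑PP-+ {n}) ⟩
    ∑PP (λ P → when (x ∼⟨ P ⟩ x) (when (isCompatible f P) (weight P))) +
    ∑PP (λ P → when (not (x ∼⟨ P ⟩ x)) (when (isCompatible f P) (weight P)))
      ≈⟨ +-cong (∑PP-cong covered) (∑PP-cong uncovered) ⟩
    ∑PP (λ P → when (x ∼⟨ P ⟩ f x) (- w (remove x P))) + ∑PP (λ P → when (u P) (w P))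
      -- Both sums now run over the partitions with x uncovered and f x covered, with opposite
      -- terms.
      ≈⟨ +-congʳ (∑-attached (miss x) (λ P → - w P)) ⟩
    ∑PP (λ P → when (u P) (- w P)) + ∑PP (λ P → when (u P) (w P))
      ≈⟨ +-congʳ (trans (∑PP-cong λ P _ → when-neg (u P)) (∑PP-neg {n})) ⟩
    - ∑PP (λ P → when (u P) (w P)) + ∑PP (λ P → when (u P) (w P))
      ≈⟨ -‿inverseˡ _ ⟩
    0# ∎
    where
    u : PRel n → Bool
    u P = not (x ∼⟨ P ⟩ x) ∧ (f x ∼⟨ P ⟩ f x)
    w : PRel n → Carrier
    w P = when (isCompatible f P) (weight P)
    covered : ∀ P → IsPP P → when (x ∼⟨ P ⟩ x) (w P) ≈ when (x ∼⟨ P ⟩ f x) (- w (remove x P))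
    covered P pp = begin
      when (x ∼⟨ P ⟩ x) (w P)
        ≈⟨ when-∧ (x ∼⟨ P ⟩ x) (isCompatible f P) ⟨
      when ((x ∼⟨ P ⟩ x) ∧ isCompatible f P) (weight P)
        ≈⟨ when-≡ (compatible-covered miss pp) ⟩
      when ((x ∼⟨ P ⟩ f x) ∧ isCompatible f (remove x P)) (weight P)
        ≈⟨ when-∧ (x ∼⟨ P ⟩ f x) _ ⟩
      when (x ∼⟨ P ⟩ f x) (when (isCompatible f (remove x P)) (weight P))
        ≈⟨ when-cong (x ∼⟨ P ⟩ f x) (λ h → trans
             (when-cong (isCompatible f (remove x P)) λ _ → weight-attached pp h (miss x))
             (when-neg (isCompatible f (remove x P)))) ⟩
      when (x ∼⟨ P ⟩ f x) (- w (remove x P)) ∎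
    uncovered : ∀ P → IsPP P → when (not (x ∼⟨ P ⟩ x)) (w P) ≈ when (u P) (w P)
    uncovered P pp = trans (sym (when-∧ (not (x ∼⟨ P ⟩ x)) (isCompatible f P)))
      (trans (when-≡ (compatible-uncovered miss pp)) (when-∧ (u P) (isCompatible f P)))

  -- For injective σ and X = `moved σ` this is `coefficient σ`. The set X is a separate argument
  -- because contracting a 2-cycle at x leaves σ x fixed but still to be covered.
  admissibleSum : (Fin n → Fin n) → (Fin n → Bool) → Carrier
  admissibleSum σ X = ∑PP (λ P → when (isAdmissible σ X P) (weight P))

  module _ {σ : Fin n → Fin n} (inj : Injective _≡_ _≡_ σ) {X : Fin n → Bool} {x : Fin n} (Xx : X x ≡ true) where

    admissibleSum-fixed : σ x ≡ x → admissibleSum σ X ≈ admissibleSum σ (X ∖ x)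
    admissibleSum-fixed σx = begin
      admissibleSum σ X
        ≈⟨ ∑PP-cong (λ P pp → trans (when-≡ (admissible-fixed inj Xx pp σx)) (when-∧ (x ∼⟨ P ⟩ x) _)) ⟩
      ∑PP (λ P → when (x ∼⟨ P ⟩ x) (when (isAdmissible σ (X ∖ x) (remove x P)) (weight P)))
        ≈⟨ ∑-remove x (isAdmissible σ (X ∖ x)) ⟩
      ∑PP (λ P → when (not (x ∼⟨ P ⟩ x)) (when (isAdmissible σ (X ∖ x) P) (weight P)))
        ≈⟨ ∑PP-cong (λ P _ → trans (when-swap (not (x ∼⟨ P ⟩ x)) (isAdmissible σ (X ∖ x) P))
             (when-cong (isAdmissible σ (X ∖ x) P) λ adm → when-true (admissible-∖-uncovers {X = X} {P = P} adm))) ⟩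
      admissibleSum σ (X ∖ x) ∎

    admissibleSum-contract : X (σ x) ≡ true → σ x ≢ x →
      admissibleSum σ X ≈ - admissibleSum (transpose x (σ x) ∘ σ) (X ∖ x)
    admissibleSum-contract Xσx σx≢x = begin
      admissibleSum σ X
        ≈⟨ ∑PP-cong contract ⟩
      ∑PP (λ P → when (x ∼⟨ P ⟩ σ x) (- w (remove x P)))
        ≈⟨ ∑-attached σx≢x (λ P → - w P) ⟩
      ∑PP (λ P → when (u P) (- w P))
        ≈⟨ ∑PP-cong uncovered ⟩
      ∑PP (λ P → - w P)
        ≈⟨ ∑PP-neg {n} ⟩
      - admissibleSum σ′ (X ∖ x) ∎
      where
      σ′ = transpose x (σ x) ∘ σ
      u : PRel n → Bool
      u P = not (x ∼⟨ P ⟩ x) ∧ (σ x ∼⟨ P ⟩ σ x)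
      w : PRel n → Carrier
      w P = when (isAdmissible σ′ (X ∖ x) P) (weight P)
      contract : ∀ P → IsPP P →
        when (isAdmissible σ X P) (weight P) ≈ when (x ∼⟨ P ⟩ σ x) (- w (remove x P))
      contract P pp = begin
        when (isAdmissible σ X P) (weight P)
          ≈⟨ trans (when-≡ (admissible-contract inj Xx pp Xσx σx≢x)) (when-∧ (x ∼⟨ P ⟩ σ x) _) ⟩
        when (x ∼⟨ P ⟩ σ x) (when (isAdmissible σ′ (X ∖ x) (remove x P)) (weight P))
          ≈⟨ when-cong (x ∼⟨ P ⟩ σ x) (λ h → trans
               (when-cong (isAdmissible σ′ (X ∖ x) (remove x P)) λ _ → weight-attached pp h σx≢x)
               (when-neg (isAdmissible σ′ (X ∖ x) (remove x P)))) ⟩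
        when (x ∼⟨ P ⟩ σ x) (- w (remove x P)) ∎
      -- Admissibility for `X ∖ x` already leaves x uncovered and covers σ x, so the guard u holds
      -- on every partition that counts.
      uncovered : ∀ P → IsPP P → when (u P) (- w P) ≈ - w P
      uncovered P pp = begin
        when (u P) (- w P)
          ≈⟨ when-cong (u P) (λ _ → when-neg (isAdmissible σ′ (X ∖ x) P)) ⟨
        when (u P) (when (isAdmissible σ′ (X ∖ x) P) (- weight P))
          ≈⟨ when-swap (u P) (isAdmissible σ′ (X ∖ x) P) ⟩
        when (isAdmissible σ′ (X ∖ x) P) (when (u P) (- weight P))
          ≈⟨ when-cong (isAdmissible σ′ (X ∖ x) P) (λ adm → when-true (∧-intro
               (admissible-∖-uncovers {X = X} {P = P} adm)
               (∼-reflʳ (proj₂ (admissible-elim P adm) (σ x) (∖-intro {X = X} Xσx σx≢x))))) ⟩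
        when (isAdmissible σ′ (X ∖ x) P) (- weight P)
          ≈⟨ when-neg (isAdmissible σ′ (X ∖ x) P) ⟩
        - w P ∎
        where open IsPP pp

  weight-empty : ∀ n → weight (emptyRel n) ≈ 1#
  weight-empty n = begin
    coverSign E * signedFact (numParts E)
      ≈⟨ *-cong (trans (Π.big-cong F λ i → Π.when-false (uncovered i)) (Π.big-ε F))
                (reflexive (≡.cong signedFact noParts)) ⟩
    -- The factors are the empty cover sign, (-1)^0, and 0! = 1 as the numeral 1 + 0.
    1# * (1# * (1# + 0#))
      ≈⟨ trans (*-identityˡ _) (trans (*-identityˡ _) (+-identityʳ _)) ⟩
    1# ∎
    where
    F = allFin n
    E = emptyRel n
    uncovered : ∀ i → ¬ (i ∼[ E ] i)
    uncovered i h = true≢false h (∼-fromRel _ i i)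
    noParts : numParts E ≡ 0
    noParts = ≡.trans (numParts-sum E)
      (≡.trans (sum-cong F λ i → whenℕ-false {isPartMin E i} (uncovered i ∘ proj₁ ∘ min-elim {P = E})) (sum-0 F))

  -- A partial partition without covered points is the empty one, so a single term of weight 1 is
  -- left. This is the base of the removal induction.
  admissibleSum-∅ : {σ : Fin n → Fin n} {X : Fin n → Bool} → (∀ i → X i ≡ false) → admissibleSum σ X ≈ 1#
  admissibleSum-∅ {n} {σ} {X} ∅ = begin
    admissibleSum σ X
      ≈⟨ big-cong (allRels n) (λ P → trans (sym (when-∧ (isPartialPartition P) (isAdmissible σ X P))) (when-≡ (eq P))) ⟩
    ∑ (allRels n) (λ P → when ⌊ P ≟ E ⌋ (weight P))
      ≈⟨ enum-δ {xs = allRels n} enumRels weight E ⟩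
    weight E
      ≈⟨ weight-empty n ⟩
    1# ∎
    where
    _≟_ = Vec.≡-dec (Vec.≡-dec Bool._≟_)
    E = emptyRel n
    empty : ∀ i j → ¬ (i ∼[ E ] j)
    empty i j h = true≢false h (∼-fromRel _ i j)
    eq : ∀ P → (isPartialPartition P ∧ isAdmissible σ X P) ≡ ⌊ P ≟ E ⌋
    eq P = bool-ext
      (λ h → let pp , adm = ∧-elim {isPartialPartition P} h in ⌊⌋-intro (P ≟ E)
        (PRel-ext λ i j → ≡.trans
          (≢true⇒≡false λ i∼j → true≢false
            (proj₁ (admissible-elim P adm) i (IsPP.∼-reflˡ (isPP-elim {P = P} pp) {i} {j} i∼j)) (∅ i))
          (≡.sym (∼-fromRel _ i j))))
      (λ h → ≡.subst (λ Q → (isPartialPartition Q ∧ isAdmissible σ X Q) ≡ true)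
        (≡.sym (⌊⌋-elim (P ≟ E) h))
        (∧-intro
          (isPP-intro {P = E} record
            { ∼-sym   = λ {i} {j} i∼j → ⊥-elim (empty i j i∼j)
            ; ∼-trans = λ {i} {j} i∼j _ → ⊥-elim (empty i j i∼j) })
          (admissible-intro E
            (λ i i∼i → ⊥-elim (empty i i i∼i)) (λ i Xi → ⊥-elim (true≢false Xi (∅ i))))))

  -- The list l holds the points still to be processed and bounds X; its head is skipped if it lies
  -- outside X. That X contains all moved points is the invariant: it lets the contraction stay
  -- inside X, and at the end, when X is empty, it forces σ to be the identity.
  admissibleSum-sign : (l : List (Fin n)) {σ : Fin n → Fin n} {X : Fin n → Bool} → Injective _≡_ _≡_ σ →
    (∀ i → X i ≡ true → i ∈ l) → (∀ i → σ i ≢ i → X i ≡ true) → admissibleSum σ X ≈ sign σ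
  admissibleSum-sign [] {σ} {X} inj X⊆l moved⊆X = trans (admissibleSum-∅ ∅) (sym (sign-id fixed))
    where
    ∅ : ∀ i → X i ≡ false
    ∅ i with X i in Xi
    ... | false = ≡.refl
    ... | true with () ← X⊆l i Xi
    fixed : ∀ i → σ i ≡ i
    fixed i with σ i Fin.≟ i
    ... | yes σi≡i = σi≡i
    ... | no  σi≢i = ⊥-elim (true≢false (moved⊆X i σi≢i) (∅ i))
  admissibleSum-sign {n} (x ∷ l) {σ} {X} inj X⊆l moved⊆X with X x in Xx
  ... | false = admissibleSum-sign l inj X⊆ moved⊆X
    where
    X⊆ : ∀ i → X i ≡ true → i ∈ l
    X⊆ i Xi with X⊆l i Xi
    ... | here ≡.refl = ⊥-elim (true≢false Xi Xx)
    ... | there i∈l   = i∈l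
  ... | true = step (σ x Fin.≟ x)
    where
    X⊆ : ∀ i → (X ∖ x) i ≡ true → i ∈ l
    X⊆ i h with ∖-elim X {x} {i} h
    ... | Xi , i≢x with X⊆l i Xi
    ... | here i≡x  = ⊥-elim (i≢x i≡x)
    ... | there i∈l = i∈l
    step : Dec (σ x ≡ x) → admissibleSum σ X ≈ sign σ
    step (yes σx≡x) = trans (admissibleSum-fixed inj Xx σx≡x) (admissibleSum-sign l inj X⊆
      λ i σi≢i → ∖-intro {X = X} (moved⊆X i σi≢i) λ { ≡.refl → σi≢i σx≡x })
    step (no σx≢x) = begin
      admissibleSum σ X
        -- By injectivity σ x is moved as well as x, so the invariant puts it in X.
        ≈⟨ admissibleSum-contract inj Xx (moved⊆X (σ x) (σx≢x ∘ inj)) σx≢x ⟩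
      - admissibleSum σ′ (X ∖ x)
        ≈⟨ -‿cong (admissibleSum-sign l (inj ∘ transpose-injective x (σ x)) X⊆ moved⊆X′) ⟩
      - sign σ′
        ≈⟨ -‿cong (sign-transpose (σx≢x ∘ ≡.sym) inj) ⟩
      - - sign σ
        ≈⟨ -‿involutive _ ⟩
      sign σ ∎
      where
      σ′ = transpose x (σ x) ∘ σ
      -- Contraction moves no new point: x becomes fixed, and a fixed point of σ is neither x nor σ
      -- x, so the transposition leaves it alone.
      moved⊆X′ : ∀ i → σ′ i ≢ i → (X ∖ x) i ≡ true
      moved⊆X′ i σ′i≢i = ∖-intro {X = X} (moved⊆X i σi≢i) i≢x
        where
        i≢x : i ≢ x
        i≢x ≡.refl = σ′i≢i (transpose-r x (σ x))
        σi≢i : σ i ≢ i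
        σi≢i σi≡i = σ′i≢i (≡.trans (≡.cong (transpose x (σ x)) σi≡i)
          (transpose-other i≢x λ i≡σx → i≢x (inj (≡.trans σi≡i i≡σx))))

  coefficient-injective : {σ : Fin n → Fin n} → Injective _≡_ _≡_ σ → coefficient σ ≈ sign σ
  coefficient-injective {n} {σ} inj = trans
    (∑PP-cong λ P pp → when-≡ (compatible-admissible inj pp))
    (admissibleSum-sign (allFin n) inj (λ i _ → ∈-allFin i) λ i σi≢i → not-intro (σi≢i ∘ ==-elim))

  -- Expansion of the product and comparison with the determinant

  ∑-*ʳ : ∀ {a} {X : Set a} (xs : List X) {f : X → Carrier} {k} → ∑ xs (λ x → f x * k) ≈ ∑ xs f * k
  ∑-*ʳ xs = trans (big-cong xs λ _ → *-comm _ _) (trans (∑-*ˡ xs) (*-comm _ _))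

  ∏-∑ : ∀ {a} {X : Set a} (xs : List X) n {g : Fin n → X → Carrier} →
    ∏ (allFin n) (λ i → ∑ xs (g i)) ≈
    ∑ (allVecsOver xs n) (λ f → ∏ (allFin n) (λ i → g i (Vec.lookup f i)))
  ∏-∑ xs zero = sym (+-identityʳ _)
  ∏-∑ xs (suc n) {g} = begin
    ∏ (allFin (suc n)) (λ i → ∑ xs (g i))
      ≈⟨ Π.big-allFin-suc {n} {λ i → ∑ xs (g i)} ⟩
    ∑ xs (g zero) * ∏ (allFin n) (λ i → ∑ xs (g (suc i)))
      ≈⟨ *-congˡ (∏-∑ xs n) ⟩
    ∑ xs (g zero) * ∑ vs (λ v → ∏ (allFin n) (λ i → g (suc i) (Vec.lookup v i)))
      ≈⟨ ∑-*ˡ vs ⟨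
    ∑ vs (λ v → ∑ xs (g zero) * ∏ (allFin n) (λ i → g (suc i) (Vec.lookup v i)))
      ≈⟨ big-cong vs (λ v → ∑-*ʳ xs) ⟨
    ∑ vs (λ v → ∑ xs (λ x → g zero x * ∏ (allFin n) (λ i → g (suc i) (Vec.lookup v i))))
      ≈⟨ big-cong vs (λ v → trans (big-map (Vec._∷ v) xs)
           (big-cong xs λ x → Π.big-allFin-suc {n} {λ i → g i (Vec.lookup (x Vec.∷ v) i)})) ⟨
    ∑ vs (λ v → ∑ (List.map (Vec._∷ v) xs) (λ f → ∏ (allFin (suc n)) (λ i → g i (Vec.lookup f i))))
      ≈⟨ big-concatMap _ vs ⟨
    ∑ (allVecsOver xs (suc n)) (λ f → ∏ (allFin (suc n)) (λ i → g i (Vec.lookup f i))) ∎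
    where vs = allVecsOver xs n

  ∏-when : ∀ {a} {X : Set a} (p : X → Bool) (xs : List X) {f : X → Carrier} →
    ∏ xs (λ x → when (p x) (f x)) ≈ when (allᵇ p xs) (∏ xs f)
  ∏-when p []       = refl
  ∏-when p (x ∷ xs) with p x
  ... | true  = trans (*-congˡ (∏-when p xs)) (when-*ˡ (allᵇ p xs))
  ... | false = zeroˡ _

  module _ (A : Matrix Carrier n) where
    private
      F = allFin n

    factor : PRel n → Fin n → Carrier
    factor P i =
      if i ∼⟨ P ⟩ i
      then ∑If (allFin n) (λ j → (j ∼⟨ P ⟩ i) ∧ not (j == i)) (λ j → A i j)
      else (A i i + ∑If (allFin n) (λ j → j ∼⟨ P ⟩ j) (λ j → A i j))

    factor-chosen : ∀ P i → factor P i ≈ ∑ F (λ j → when (isChosen P i j) (A i j))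
    factor-chosen P i with i ∼⟨ P ⟩ i in e
    ... | true  = big-filter _ F
    ... | false = begin
      A i i + ∑If F (λ j → j ∼⟨ P ⟩ j) (A i)
        ≈⟨ +-cong (sym (enum-δ {xs = F} enum-allFin (A i) i)) (big-filter _ F) ⟩
      ∑ F (λ j → when (j == i) (A i j)) + ∑ F (λ j → when (j ∼⟨ P ⟩ j) (A i j))
        ≈⟨ big-∙ F ⟨
      ∑ F (λ j → when (j == i) (A i j) + when (j ∼⟨ P ⟩ j) (A i j))
        -- The two guards exclude each other because i is uncovered in this case, so the diagonal
        -- entry is not counted twice.
        ≈⟨ big-cong F (λ j → when-∨ (j == i) (j ∼⟨ P ⟩ j) λ j≡i j∼j →
             true≢false (≡.subst (λ k → k ∼[ P ] k) (==-elim j≡i) j∼j) e) ⟨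
      ∑ F (λ j → when ((j == i) ∨ (j ∼⟨ P ⟩ j)) (A i j)) ∎

    monomial : Vec (Fin n) n → Carrier
    monomial f = ∏ F (λ i → A i (Vec.lookup f i))

    ∏-factor : ∀ P → ∏ F (factor P) ≈
      ∑ (allVecsOver F n) (λ f → when (isCompatible (Vec.lookup f) P) (monomial f))
    ∏-factor P = begin
      ∏ F (factor P)
        ≈⟨ Π.big-cong F (factor-chosen P) ⟩
      ∏ F (λ i → ∑ F (λ j → when (isChosen P i j) (A i j)))
        ≈⟨ ∏-∑ F n ⟩
      ∑ (allVecsOver F n) (λ f → ∏ F (λ i → when (isChosen P i (Vec.lookup f i)) (A i (Vec.lookup f i))))
        ≈⟨ big-cong (allVecsOver F n) (λ f → ∏-when (λ i → isChosen P i (Vec.lookup f i)) F) ⟩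
      ∑ (allVecsOver F n) (λ f → when (isCompatible (Vec.lookup f) P) (monomial f)) ∎

    -- By finiteness f either is a permutation, with coefficient its sign, or misses a value, with
    -- coefficient 0 and no term in `det`.
    coefficient-det : ∀ f → when (isPermutation f) (neg1^ (inversions f) * monomial f) ≈
      coefficient (Vec.lookup f) * monomial f
    coefficient-det f with isPermutation f in e
    ... | true  = *-congʳ (trans (neg1^-inversions f) (sym (coefficient-injective inj)))
      where
      inj : Injective _≡_ _≡_ (Vec.lookup f)
      inj {i} {j} eq = ==-elim (⇒ᵇ-elim (allᵇ-elim (allᵇ-elim e i) j) (==-intro eq))
    ... | false with Fin.any? (λ x → Fin.all? (λ i → ¬? (Vec.lookup f i Fin.≟ x)))
    ...   | yes (x , miss) = sym (trans (*-congʳ (coefficient-nonsurjective miss)) (zeroˡ _))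
    ...   | no surj = ⊥-elim (true≢false perm e)
      where
      section : ∀ x → ∃ λ i → Vec.lookup f i ≡ x
      section x with Fin.any? (λ i → Vec.lookup f i Fin.≟ x)
      ... | yes hit = hit
      ... | no none = ⊥-elim (surj (x , λ i eq → none (i , eq)))
      -- As a right inverse of f, g is injective and hence onto. Every index is then of the form g
      -- x, which makes f injective.
      g = proj₁ ∘ section
      f∘g : ∀ x → Vec.lookup f (g x) ≡ x
      f∘g = proj₂ ∘ section
      g-injective : Injective _≡_ _≡_ g
      g-injective {x} {y} eq = ≡.trans (≡.sym (f∘g x)) (≡.trans (≡.cong (Vec.lookup f) eq) (f∘g y))
      inj : ∀ i j → Vec.lookup f i ≡ Vec.lookup f j → i ≡ j
      inj i j eq with injective⇒surjective g-injective i | injective⇒surjective g-injective j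
      ... | x , ≡.refl | y , ≡.refl = ≡.cong g (≡.trans (≡.sym (f∘g x)) (≡.trans eq (f∘g y)))
      perm : isPermutation f ≡ true
      perm = allᵇ-intro {n} λ i → allᵇ-intro {n} λ j → ⇒ᵇ-intro λ h → ==-intro (inj i j (==-elim h))

    -- The two sides agree monomial by monomial once the sum over partitions and the sum over maps
    -- are exchanged.
    det-PP : det A ≈ ∑ (PP n) (λ P → (sgnPP P * ⟦ numParts P ! ⟧) * ∏ F (factor P))
    det-PP = begin
      ∑ (permutations n) (λ f → neg1^ (inversions f) * monomial f)
        ≈⟨ big-filter isPermutation V ⟩
      ∑ V (λ f → when (isPermutation f) (neg1^ (inversions f) * monomial f))
        ≈⟨ big-cong V coefficient-det ⟩
      ∑ V (λ f → coefficient (Vec.lookup f) * monomial f)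
        ≈⟨ big-cong V (λ f → trans (*-comm _ _) (trans (sym (∑-*ˡ (allRels n)))
             (big-cong (allRels n) λ P → when-*ˡ (isPartialPartition P)))) ⟩
      ∑ V (λ f → ∑PP (λ P → monomial f * when (isCompatible (Vec.lookup f) P) (weight P)))
        ≈⟨ ∑PP-swap {n} V ⟨
      ∑PP (λ P → ∑ V (λ f → monomial f * when (isCompatible (Vec.lookup f) P) (weight P)))
        ≈⟨ ∑PP-cong (λ P _ → trans (big-cong V λ f → move (isCompatible (Vec.lookup f) P)) (∑-*ˡ V)) ⟩
      ∑PP (λ P → weight P * ∑ V (λ f → when (isCompatible (Vec.lookup f) P) (monomial f)))
        ≈⟨ ∑PP-cong (λ P pp → *-cong (sym (weight-sgnPP pp)) (sym (∏-factor P))) ⟩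
      ∑PP (λ P → (sgnPP P * ⟦ numParts P ! ⟧) * ∏ F (factor P))
        ≈⟨ big-filter isPartialPartition (allRels n) ⟨
      ∑ (PP n) (λ P → (sgnPP P * ⟦ numParts P ! ⟧) * ∏ F (factor P)) ∎
      where
      V = allVecsOver F n
      move : ∀ b {g h} → g * when b h ≈ h * when b g
      move true  = *-comm _ _
      move false = trans (zeroʳ _) (sym (zeroʳ _))

theorem2p1 : ∀ {c ℓ} (F : Field c ℓ) (n : ℕ) → n ≥ 1 →
    let open Field F
        open RingOps commutativeRing
    in (A : Matrix Carrier n) →
      det A ≈
        ∑ (PP n) (λ P → (sgnPP P * ⟦ numParts P ! ⟧) *
          ∏ (allFin n) (λ i →
            if i ∼⟨ P ⟩ i
            then ∑If (allFin n) (λ j → (j ∼⟨ P ⟩ i) ∧ not (j == i)) (λ j → A i j)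
            else (A i i + ∑If (allFin n) (λ j → j ∼⟨ P ⟩ j) (λ j → A i j))))
theorem2p1 F n _ = Coefficients.det-PP (Field.commutativeRing F)
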